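{- Let $X$ be a strongly connected finite digraph with $\delta(X)=0$. Then $\#\mathcal{R}(X)=|m(X)|$, where $\mathcal{R}(X)=\mathcal{BF}_X(\mathbb{Z}V_X)/\mathcal{BF}_X(\mathcal{L}(X))$ and $m(X)=g_X^*(1)/\#\mathrm{BF}(X)_{\rm tors}$.
   Context: Digraph $X=(V_X,E_X)$ with incidence $e\mapsto(o(e),t(e))$; strongly connected means a directed path exists between any two distinct vertices. For finite $X$: $\mathcal{A}_X(v)=\sum_{o(e)=v}t(e)$ on $\mathbb{Z}V_X$, $\mathcal{BF}_X=\mathcal{I}-\mathcal{A}_X$, $\mathrm{BF}(X)=\mathrm{coker}\,\mathcal{BF}_X$, $g_X(u)=\det(\mathcal{I}-\mathcal{A}_Xu)\in\mathbb{Z}[u]$, $r_X=\mathrm{ord}_{u=1}g_X$, $g_X^*(1)$ the coefficient of $(u-1)^{r_X}$ in the Taylor expansion of $g_X$ at $1$, $\delta(X)=r_X-\mathrm{rank}_{\mathbb{Z}}\mathrm{BF}(X)$. When $\delta(X)=0$, $g_X^*(1)$ is a nonzero integer multiple of $\#\mathrm{BF}(X)_{\rm tors}$, and $m(X)$ denotes this integer. $\mathcal{L}(X)=\mathbb{Z}V_X\cap\mathrm{Im}(\mathcal{BF}_{\mathbb{Q}})$ inside $\mathbb{Q}V_X$, where $\mathcal{BF}_{\mathbb{Q}}$ is the extension of $\mathcal{BF}_X$ to $\mathbb{Q}V_X$. -}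

module Defs where

open import Algebra.Bundles using (AbelianGroup; CommutativeRing; RawRing)
import Algebra.Construct.Pointwise as Pointwise
import Algebra.Definitions.RawMonoid as RawMonoidDefs
import Algebra.Definitions.RawSemiring as RawSemiringDefs
open import Algebra.Morphism.Bundles using (GroupHomomorphism)
import Algebra.Properties.AbelianGroup as AbelianGroupProperties
import Algebra.Properties.CommutativeMonoid.Mult as Mult
import Algebra.Properties.CommutativeSemigroup as CommutativeSemigroupProperties
import Algebra.Properties.Ring as RingProperties
import Algebra.Properties.Semiring.Sum as SemiringSum
open import Data.Bool.Base using (if_then_else_)
open import Data.Fin.Base using (Fin; zero; suc; toℕ; punchIn)
import Data.Fin.Properties as Fin
open import Data.Integer.Base as ℤ using (ℤ; +_; -[1+_]; 0ℤ; 1ℤ; -1ℤ)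
import Data.Integer.Properties as ℤ
open import Data.List.Base using (List; []; _∷_; map)
open import Data.Nat.Base as ℕ using (ℕ; zero; suc)
import Data.Nat.Properties as ℕ
open import Data.Product.Base using (Σ; ∃; ∃-syntax; _×_; _,_; proj₁; proj₂)
open import Data.Rational.Base as ℚ using (ℚ; _/_)
import Data.Rational.Properties as ℚ
import Data.Rational.Unnormalised.Base as ℚᵘ
import Data.Rational.Unnormalised.Properties as ℚᵘ
open import Data.Sum.Base using ([_,_])
open import Data.Unit.Base using (⊤; tt)
open import Data.Vec.Functional using (Vector)
open import Function.Base using (_∘_)
open import Function.Bundles using (Inverse)
open import Level using (0ℓ)
open import Relation.Binary.Construct.Closure.ReflexiveTransitive using (Star)
open import Relation.Binary.PropositionalEquality as ≡ using (_≡_; _≢_)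
import Relation.Binary.Reasoning.Setoid as SetoidReasoning
open import Relation.Nullary.Decidable.Core using (does)
open import Relation.Nullary.Negation.Core using (¬_)

AbGroup : Set₁
AbGroup = AbelianGroup 0ℓ 0ℓ

Hom : AbGroup → AbGroup → Set
Hom G H = GroupHomomorphism (AbelianGroup.rawGroup G) (AbelianGroup.rawGroup H)

record Subgroup (G : AbGroup) : Set₁ where
  open AbelianGroup G
  field
    _∈        : Carrier → Set
    ∈-resp-≈  : ∀ {x y} → x ≈ y → x ∈ → y ∈
    ε∈        : ε ∈
    ∙-closed  : ∀ {x y} → x ∈ → y ∈ → (x ∙ y) ∈
    ⁻¹-closed : ∀ {x} → x ∈ → (x ⁻¹) ∈

whole : (G : AbGroup) → Subgroup G
whole G = record
  { _∈        = λ _ → ⊤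
  ; ∈-resp-≈  = λ _ _ → tt
  ; ε∈        = tt
  ; ∙-closed  = λ _ _ → tt
  ; ⁻¹-closed = λ _ → tt
  }

infix 4 _⊆_

_⊆_ : {G : AbGroup} → Subgroup G → Subgroup G → Set
S ⊆ T = ∀ {x} → x S.∈ → x T.∈
  where
  module S = Subgroup S
  module T = Subgroup T

image : {G H : AbGroup} → Hom G H → Subgroup G → Subgroup H
image {G} {H} φ S = record
  { _∈        = λ y → ∃[ x ] ((x S.∈) × (⟦ x ⟧ ≈ y))
  ; ∈-resp-≈  = λ y≈z (x , x∈ , p) → x , x∈ , trans p y≈z
  ; ε∈        = G.ε , S.ε∈ , ε-homo
  ; ∙-closed  = λ (x , x∈ , p) (y , y∈ , q) →
                  x G.∙ y , S.∙-closed x∈ y∈ , trans (homo x y) (∙-cong p q)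
  ; ⁻¹-closed = λ (x , x∈ , p) →
                  x G.⁻¹ , S.⁻¹-closed x∈ , trans (⁻¹-homo x) (⁻¹-cong p)
  }
  where
  module G = AbelianGroup G
  module S = Subgroup S
  open AbelianGroup H
  open GroupHomomorphism φ using (⟦_⟧; ε-homo; homo; ⁻¹-homo)

preimage : {G H : AbGroup} → Hom G H → Subgroup H → Subgroup G
preimage {G} {H} φ T = record
  { _∈        = λ x → ⟦ x ⟧ T.∈
  ; ∈-resp-≈  = λ x≈y → T.∈-resp-≈ (⟦⟧-cong x≈y)
  ; ε∈        = T.∈-resp-≈ (sym ε-homo) T.ε∈
  ; ∙-closed  = λ x∈ y∈ → T.∈-resp-≈ (sym (homo _ _)) (T.∙-closed x∈ y∈)
  ; ⁻¹-closed = λ x∈ → T.∈-resp-≈ (sym (⁻¹-homo _)) (T.⁻¹-closed x∈)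
  }
  where
  module T = Subgroup T
  open AbelianGroup H
  open GroupHomomorphism φ using (⟦_⟧; ⟦⟧-cong; ε-homo; homo; ⁻¹-homo)

subgroupAsGroup : {G : AbGroup} → Subgroup G → AbGroup
subgroupAsGroup {G} S = record
  { Carrier        = Σ Carrier _∈
  ; _≈_            = λ x y → proj₁ x ≈ proj₁ y
  ; _∙_            = λ (x , x∈) (y , y∈) → x ∙ y , ∙-closed x∈ y∈
  ; ε              = ε , ε∈
  ; _⁻¹            = λ (x , x∈) → x ⁻¹ , ⁻¹-closed x∈
  ; isAbelianGroup = record
    { isGroup = record
      { isMonoid = record
        { isSemigroup = record
          { isMagma = record
            { isEquivalence = record { refl = refl ; sym = sym ; trans = trans }
            ; ∙-cong        = ∙-cong
            }
          ; assoc = λ x y z → assoc (proj₁ x) (proj₁ y) (proj₁ z)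
          }
        ; identity = (λ x → identityˡ (proj₁ x)) , (λ x → identityʳ (proj₁ x))
        }
      ; inverse = (λ x → inverseˡ (proj₁ x)) , (λ x → inverseʳ (proj₁ x))
      ; ⁻¹-cong = ⁻¹-cong
      }
    ; comm = λ x y → comm (proj₁ x) (proj₁ y)
    }
  }
  where
  open AbelianGroup G
  open Subgroup S

-- Agda has no quotient types: G / S is the group G whose equality is coarsened
-- to congruence modulo S.
quotient : (G : AbGroup) → Subgroup G → AbGroup
quotient G S = record
  { Carrier        = Carrier
  ; _≈_            = λ x y → (x ∙ y ⁻¹) ∈
  ; _∙_            = _∙_
  ; ε              = ε
  ; _⁻¹            = _⁻¹
  ; isAbelianGroup = record
    { isGroup = record
      { isMonoid = record
        { isSemigroup = record
          { isMagma = record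
            { isEquivalence = record
              { refl  = ≈⇒∈ refl
              ; sym   = λ {x} {y} p → ∈-resp-≈ (⁻¹-anti-homo‿- x y) (⁻¹-closed p)
              ; trans = λ {x} {y} {z} p q → ∈-resp-≈ (telescope x y z) (∙-closed p q)
              }
            ; ∙-cong = λ {x} {y} {u} {v} p q →
                         ∈-resp-≈ (rearrange x y u v) (∙-closed p q)
            }
          ; assoc = λ x y z → ≈⇒∈ (assoc x y z)
          }
        ; identity = (λ x → ≈⇒∈ (identityˡ x)) , (λ x → ≈⇒∈ (identityʳ x))
        }
      ; inverse = (λ x → ≈⇒∈ (inverseˡ x)) , (λ x → ≈⇒∈ (inverseʳ x))
      ; ⁻¹-cong = λ {x} {y} p → ∈-resp-≈ (sym (⁻¹-∙-comm x (y ⁻¹))) (⁻¹-closed p)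
      }
    ; comm = λ x y → ≈⇒∈ (comm x y)
    }
  }
  where
  open AbelianGroup G
  open AbelianGroupProperties G
  open CommutativeSemigroupProperties commutativeSemigroup using (interchange)
  open Subgroup S
  open SetoidReasoning setoid

  ≈⇒∈ : ∀ {x y} → x ≈ y → (x ∙ y ⁻¹) ∈
  ≈⇒∈ x≈y = ∈-resp-≈ (sym (x≈y⇒x∙y⁻¹≈ε x≈y)) ε∈

  telescope : ∀ x y z → (x ∙ y ⁻¹) ∙ (y ∙ z ⁻¹) ≈ x ∙ z ⁻¹
  telescope x y z = begin
    (x ∙ y ⁻¹) ∙ (y ∙ z ⁻¹)  ≈⟨ assoc x (y ⁻¹) (y ∙ z ⁻¹) ⟩
    x ∙ (y ⁻¹ ∙ (y ∙ z ⁻¹))  ≈⟨ ∙-congˡ (\\-leftDividesʳ y (z ⁻¹)) ⟩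
    x ∙ z ⁻¹                 ∎

  rearrange : ∀ x y u v → (x ∙ y ⁻¹) ∙ (u ∙ v ⁻¹) ≈ (x ∙ u) ∙ (y ∙ v) ⁻¹
  rearrange x y u v = begin
    (x ∙ y ⁻¹) ∙ (u ∙ v ⁻¹)  ≈⟨ interchange x (y ⁻¹) u (v ⁻¹) ⟩
    (x ∙ u) ∙ (y ⁻¹ ∙ v ⁻¹)  ≈⟨ ∙-congˡ (⁻¹-∙-comm y v) ⟩
    (x ∙ u) ∙ (y ∙ v) ⁻¹     ∎

subquotient : {G : AbGroup} (S T : Subgroup G) → T ⊆ S → AbGroup
subquotient {G} S T T⊆S = quotient (subgroupAsGroup S) (record
  { _∈        = λ x → proj₁ x ∈
  ; ∈-resp-≈  = ∈-resp-≈
  ; ε∈        = ε∈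
  ; ∙-closed  = ∙-closed
  ; ⁻¹-closed = ⁻¹-closed
  })
  where open Subgroup T

cokernel : {G H : AbGroup} → Hom G H → AbGroup
cokernel {G} {H} φ = quotient H (image {G} {H} φ (whole G))

torsion : (G : AbGroup) → Subgroup G
torsion G = record
  { _∈        = λ x → ∃[ k ] (k ≢ 0 × k · x ≈ ε)
  ; ∈-resp-≈  = λ x≈y (k , k≢0 , p) → k , k≢0 , trans (×-congʳ k (sym x≈y)) p
  ; ε∈        = 1 , (λ ()) , ·-zero 1
  ; ∙-closed  = λ (k , k≢0 , p) (l , l≢0 , q) →
                  k ℕ.* l , *≢0 k≢0 l≢0 ,
                  trans (×-distrib-+ _ _ (k ℕ.* l))
                        (trans (∙-cong (annihilateˡ l {k} p) (annihilateʳ k {l} q))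
                               (identityˡ ε))
  ; ⁻¹-closed = λ (k , k≢0 , p) → k , k≢0 , ·-⁻¹ k p
  }
  where
  open AbelianGroup G
  open Mult commutativeMonoid renaming (_×_ to _·_)

  *≢0 : ∀ {k l} → k ≢ 0 → l ≢ 0 → k ℕ.* l ≢ 0
  *≢0 {k} k≢0 l≢0 = [ k≢0 , l≢0 ] ∘ ℕ.m*n≡0⇒m≡0∨n≡0 k

  ·-zero : ∀ k → k · ε ≈ ε
  ·-zero zero    = refl
  ·-zero (suc k) = trans (identityˡ _) (·-zero k)

  annihilateʳ : ∀ k {l y} → l · y ≈ ε → (k ℕ.* l) · y ≈ ε
  annihilateʳ k {l} {y} p =
    trans (sym (×-assocˡ y k l)) (trans (×-congʳ k p) (·-zero k))

  annihilateˡ : ∀ l {k x} → k · x ≈ ε → (k ℕ.* l) · x ≈ ε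
  annihilateˡ l {k} {x} p =
    trans (reflexive (≡.cong (_· x) (ℕ.*-comm k l))) (annihilateʳ l {k} p)

  ·-⁻¹ : ∀ k {x} → k · x ≈ ε → k · (x ⁻¹) ≈ ε
  ·-⁻¹ k {x} p = begin
    k · (x ⁻¹)            ≈⟨ identityˡ _ ⟨
    ε ∙ k · (x ⁻¹)        ≈⟨ ∙-congʳ p ⟨
    k · x ∙ k · (x ⁻¹)    ≈⟨ ×-distrib-+ x (x ⁻¹) k ⟨
    k · (x ∙ x ⁻¹)        ≈⟨ ×-congʳ k (inverseʳ x) ⟩
    k · ε                 ≈⟨ ·-zero k ⟩
    ε                     ∎
    where open SetoidReasoning setoid

HasCardinality : AbGroup → ℕ → Set
HasCardinality G N = Inverse (≡.setoid (Fin N)) (AbelianGroup.setoid G)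

module _ (G : AbGroup) where
  open AbelianGroup G
  open RawMonoidDefs rawMonoid using (sum) renaming (_×_ to _×ℕ_)

  _·ℤ_ : ℤ → Carrier → Carrier
  (+ k)    ·ℤ x = k ×ℕ x
  -[1+ k ] ·ℤ x = (suc k ×ℕ x) ⁻¹

  ℤ-Independent : ∀ {k} → Vector Carrier k → Set
  ℤ-Independent {k} x =
    (c : Vector ℤ k) → sum (λ i → c i ·ℤ x i) ≈ ε → ∀ i → c i ≡ 0ℤ

  -- The rank is the maximal size of a ℤ-linearly independent family.  Forbidding
  -- size k + 1 is enough, since subfamilies of independent families are independent.
  HasRank : ℕ → Set
  HasRank k = (∃[ x ] ℤ-Independent {k} x) ×
              ((x : Vector Carrier (suc k)) → ¬ ℤ-Independent x)

Matrix : Set → ℕ → Set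
Matrix A n = Fin n → Fin n → A

module Determinant (R : RawRing 0ℓ 0ℓ) where
  open RawRing R
  open RawMonoidDefs +-rawMonoid using (sum)
  open RawSemiringDefs rawSemiring using (_^_)

  minor : ∀ {n} → Matrix Carrier (suc n) → Fin (suc n) → Matrix Carrier n
  minor M j i k = M (suc i) (punchIn j k)

  -- Laplace expansion along the first row.
  det : ∀ {n} → Matrix Carrier n → Carrier
  det {zero}  M = 1#
  det {suc n} M = sum (λ j → ((- 1#) ^ toℕ j) * (M zero j * det (minor M j)))

module FreeModule (R : CommutativeRing 0ℓ 0ℓ) where
  open CommutativeRing R
  open SemiringSum semiring using (sum; sum-cong-≋; ∑-distrib-+; *-distribˡ-sum)
  open RingProperties ring using (-1*x≈-x)

  free : ℕ → AbGroup
  free n = Pointwise.abelianGroup (Fin n) +-abelianGroup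

  apply : ∀ {n} → Matrix Carrier n → Vector Carrier n → Vector Carrier n
  apply M x i = sum (λ j → M i j * x j)

  matrixHom : ∀ {n} → Matrix Carrier n → Hom (free n) (free n)
  matrixHom {n} M = record
    { ⟦_⟧ = apply M
    ; isGroupHomomorphism = record
      { isMonoidHomomorphism = record
        { isMagmaHomomorphism = record
          { isRelHomomorphism = record
            { cong = λ x≈y i → sum-cong-≋ (λ j → *-congˡ (x≈y j)) }
          ; homo = apply-+
          }
        ; ε-homo = apply-0
        }
      ; ⁻¹-homo = apply-neg
      }
    }
    where
    sum-cong : {x y : Vector Carrier n} → (∀ j → x j ≈ y j) → sum x ≈ sum y
    sum-cong = sum-cong-≋

    apply-+ : ∀ x y i → apply M (λ j → x j + y j) i ≈ apply M x i + apply M y i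
    apply-+ x y i = trans (sum-cong (λ j → distribˡ (M i j) (x j) (y j)))
                          (∑-distrib-+ (λ j → M i j * x j) (λ j → M i j * y j))

    scale : ∀ a x i → apply M (λ j → a * x j) i ≈ a * apply M x i
    scale a x i = trans
      (sum-cong (λ j → trans (sym (*-assoc _ _ _))
                        (trans (*-congʳ (*-comm _ _)) (*-assoc _ _ _))))
      (sym (*-distribˡ-sum a (λ j → M i j * x j)))

    apply-0 : ∀ i → apply M (λ _ → 0#) i ≈ 0#
    apply-0 i = trans (sum-cong (λ j → *-congˡ (sym (zeroˡ 0#))))
                      (trans (scale 0# (λ _ → 0#) i) (zeroˡ _))

    apply-neg : ∀ x i → apply M (λ j → - x j) i ≈ - apply M x i
    apply-neg x i = trans (sum-cong (λ j → *-congˡ (sym (-1*x≈-x (x j)))))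
                          (trans (scale (- 1#) x i) (-1*x≈-x _))

module ℤMod = FreeModule ℤ.+-*-commutativeRing
module ℚMod = FreeModule ℚ.+-*-commutativeRing

toℚ : ℤ → ℚ
toℚ i = i / 1

ℤ⊆ℚ : ∀ n → Hom (ℤMod.free n) (ℚMod.free n)
ℤ⊆ℚ n = record
  { ⟦_⟧ = λ x i → toℚ (x i)
  ; isGroupHomomorphism = record
    { isMonoidHomomorphism = record
      { isMagmaHomomorphism = record
        { isRelHomomorphism = record { cong = λ x≈y i → ≡.cong toℚ (x≈y i) }
        ; homo = λ x y i → toℚ-+ (x i) (y i)
        }
      ; ε-homo = λ _ → ≡.refl
      }
    ; ⁻¹-homo = λ x i → toℚ-neg (x i)
    }
  }
  where
  toℚᵘ-toℚ : ∀ i → ℚ.toℚᵘ (toℚ i) ℚᵘ.≃ ℚᵘ.mkℚᵘ i 0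
  toℚᵘ-toℚ i = ℚ.toℚᵘ-fromℚᵘ (ℚᵘ.mkℚᵘ i 0)

  open SetoidReasoning ℚᵘ.≃-setoid

  toℚ-+ : ∀ i j → toℚ (i ℤ.+ j) ≡ toℚ i ℚ.+ toℚ j
  toℚ-+ i j = ℚ.toℚᵘ-injective (begin
    ℚ.toℚᵘ (toℚ (i ℤ.+ j))                 ≈⟨ toℚᵘ-toℚ (i ℤ.+ j) ⟩
    ℚᵘ.mkℚᵘ (i ℤ.+ j) 0                    ≡⟨ ≡.cong (λ k → ℚᵘ.mkℚᵘ k 0)
                                                (≡.sym (≡.cong₂ ℤ._+_ (ℤ.*-identityʳ i) (ℤ.*-identityʳ j))) ⟩
    ℚᵘ.mkℚᵘ i 0 ℚᵘ.+ ℚᵘ.mkℚᵘ j 0           ≈⟨ ℚᵘ.+-cong (toℚᵘ-toℚ i) (toℚᵘ-toℚ j) ⟨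
    ℚ.toℚᵘ (toℚ i) ℚᵘ.+ ℚ.toℚᵘ (toℚ j)     ≈⟨ ℚ.toℚᵘ-homo-+ (toℚ i) (toℚ j) ⟨
    ℚ.toℚᵘ (toℚ i ℚ.+ toℚ j)               ∎)

  toℚ-neg : ∀ i → toℚ (ℤ.- i) ≡ ℚ.- toℚ i
  toℚ-neg i = ℚ.toℚᵘ-injective (begin
    ℚ.toℚᵘ (toℚ (ℤ.- i))      ≈⟨ toℚᵘ-toℚ (ℤ.- i) ⟩
    ℚᵘ.- ℚᵘ.mkℚᵘ i 0          ≈⟨ ℚᵘ.-‿cong (toℚᵘ-toℚ i) ⟨
    ℚᵘ.- ℚ.toℚᵘ (toℚ i)       ≈⟨ ℚ.toℚᵘ-homo‿- (toℚ i) ⟨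
    ℚ.toℚᵘ (ℚ.- toℚ i)        ∎)

-- Coefficients, constant term first; trailing zeros are allowed, so polynomials
-- are compared by their coefficients.
ℤ[u] : Set
ℤ[u] = List ℤ

coeff : ℤ[u] → ℕ → ℤ
coeff []      _       = 0ℤ
coeff (c ∷ _) zero    = c
coeff (_ ∷ p) (suc k) = coeff p k

const : ℤ → ℤ[u]
const c = c ∷ []

u : ℤ[u]
u = 0ℤ ∷ 1ℤ ∷ []

infixl 6 _+ₚ_
infixl 7 _*ₚ_

_+ₚ_ : ℤ[u] → ℤ[u] → ℤ[u]
[]      +ₚ q       = q
(a ∷ p) +ₚ []      = a ∷ p
(a ∷ p) +ₚ (b ∷ q) = a ℤ.+ b ∷ p +ₚ q

-ₚ_ : ℤ[u] → ℤ[u]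
-ₚ p = map (ℤ.-_) p

_*ₚ_ : ℤ[u] → ℤ[u] → ℤ[u]
[]      *ₚ q = []
(a ∷ p) *ₚ q = map (a ℤ.*_) q +ₚ (0ℤ ∷ p *ₚ q)

ℤ[u]-rawRing : RawRing 0ℓ 0ℓ
ℤ[u]-rawRing = record
  { Carrier = ℤ[u]
  ; _≈_     = λ p q → ∀ k → coeff p k ≡ coeff q k
  ; _+_     = _+ₚ_
  ; _*_     = _*ₚ_
  ; -_      = -ₚ_
  ; 0#      = []
  ; 1#      = const 1ℤ
  }

-- p(1 + t) as a polynomial in t: its coefficient of t^k is the coefficient of
-- (u - 1)^k in the Taylor expansion of p at 1.
taylor₁ : ℤ[u] → ℤ[u]
taylor₁ []      = []
taylor₁ (c ∷ p) = const c +ₚ (1ℤ ∷ 1ℤ ∷ []) *ₚ taylor₁ p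

-- Index of the first nonzero coefficient; meaningless for the zero polynomial.
order₀ : ℤ[u] → ℕ
order₀ []      = 0
order₀ (c ∷ p) = if does (c ℤ.≟ 0ℤ) then suc (order₀ p) else 0

order₁ : ℤ[u] → ℕ
order₁ p = order₀ (taylor₁ p)

-- Finite digraphs; loops and parallel edges are allowed.
record Digraph : Set where
  field
    #V  : ℕ
    #E  : ℕ
    o t : Fin #E → Fin #V

  V = Fin #V
  E = Fin #E

  Adjacent : V → V → Set
  Adjacent v w = ∃[ e ] (o e ≡ v × t e ≡ w)

  StronglyConnected : Set
  StronglyConnected = ∀ v w → v ≢ w → Star Adjacent v w

  ℤV ℚV : AbGroup
  ℤV = ℤMod.free #V
  ℚV = ℚMod.free #V

  basis : V → Vector ℤ #V
  basis v w = if does (v Fin.≟ w) then 1ℤ else 0ℤ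

  𝓐-on : V → Vector ℤ #V
  𝓐-on v = sum (λ e → if does (o e Fin.≟ v) then basis (t e) else ε)
    where
    open AbelianGroup ℤV using (rawMonoid; ε)
    open RawMonoidDefs rawMonoid using (sum)

  -- Matrices act on column vectors, so column v holds the image of v.
  𝓘-matrix 𝓐-matrix 𝓑𝓕-matrix : Matrix ℤ #V
  𝓘-matrix  w v = basis v w
  𝓐-matrix  w v = 𝓐-on v w
  𝓑𝓕-matrix w v = 𝓘-matrix w v ℤ.- 𝓐-matrix w v

  𝓑𝓕 : Hom ℤV ℤV
  𝓑𝓕 = ℤMod.matrixHom 𝓑𝓕-matrix

  𝓑𝓕ℚ : Hom ℚV ℚV
  𝓑𝓕ℚ = ℚMod.matrixHom (λ w v → toℚ (𝓑𝓕-matrix w v))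

  BF : AbGroup
  BF = cokernel {ℤV} {ℤV} 𝓑𝓕

  g : ℤ[u]
  g = Determinant.det ℤ[u]-rawRing
        (λ w v → const (𝓘-matrix w v) +ₚ (-ₚ (const (𝓐-matrix w v) *ₚ u)))

  -- g has constant term 1, so it is not the zero polynomial.
  r : ℕ
  r = order₁ g

  g* : ℤ
  g* = coeff (taylor₁ g) r

  -- δ(X) = d
  HasDefect : ℤ → Set
  HasDefect d = ∃[ ρ ] (HasRank BF ρ × d ≡ + r ℤ.- + ρ)

  -- m(X) = m
  HasMultiplier : ℤ → Set
  HasMultiplier m =
    ∃[ τ ] (HasCardinality (subgroupAsGroup (torsion BF)) τ × g* ≡ m ℤ.* + τ)

  𝓛 : Subgroup ℤV
  𝓛 = preimage {ℤV} {ℚV} (ℤ⊆ℚ #V) (image {ℚV} {ℚV} 𝓑𝓕ℚ (whole ℚV))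

  𝓑𝓕[ℤV] 𝓑𝓕[𝓛] : Subgroup ℤV
  𝓑𝓕[ℤV] = image {ℤV} {ℤV} 𝓑𝓕 (whole ℤV)
  𝓑𝓕[𝓛]  = image {ℤV} {ℤV} 𝓑𝓕 𝓛

  𝓡 : AbGroup
  𝓡 = subquotient 𝓑𝓕[ℤV] 𝓑𝓕[𝓛] (λ (x , _ , p) → x , tt , p)

{-# OPTIONS --safe #-}

-- Write B for the matrix of 𝓑𝓕.  Integer row and column operations give B = P D Q with
-- D = diag d and P, Q unimodular.  Put W = Q P, let z be the number of zeros of d, let d′
-- be d with its zeros replaced by 1, and let N agree with W on the columns where d is
-- nonzero and with the identity on the others.  In the coordinates given by P the
-- saturation of the image of B is spanned by the basis vectors with d i ≠ 0, so the torsion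
-- of BF has order |∏ d′|; moreover y ↦ P D y identifies ℤⁿ / N ℤⁿ with 𝓡, which thus has
-- order |det N| as soon as det N ≠ 0.  At u = 1 + t the matrix I - A u is (1 + t) B - t I.
-- Conjugated by Q it becomes (1 + t) W D - t I, where each zero of d contributes a column
-- - t eⱼ, so g(1 + t) = (- t)^z h(t) with h(0) = det N · ∏ d′.  Hence the order of vanishing
-- r is at least z, while the rank of BF is at most z; δ = 0 then forces r = z and
-- g* = ± det N · ∏ d′ ≠ 0.  Polynomials only enter through their values at integers.

module Submission where

open import Defs
open import Data.Integer.Base using (ℤ; 0ℤ; ∣_∣)
open import Data.Product.Base using (_×_; ∃-syntax)

open import Algebra.Bundles using (AbelianGroup; CommutativeRing; Monoid; RawRing)
import Algebra.Definitions.RawMonoid as RawMonoidDefs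
import Algebra.Definitions.RawSemiring as RawSemiringDefs
open import Algebra.Morphism.Bundles using (GroupHomomorphism)
import Algebra.Properties.CommutativeMonoid.Sum as CommutativeMonoidSum
import Algebra.Properties.CommutativeSemigroup as CommutativeSemigroupProperties
import Algebra.Properties.Monoid as MonoidProperties
import Algebra.Properties.Semiring.Sum as SemiringSum
open import Data.Bool.Base using (if_then_else_)
open import Data.Fin.Base using (Fin; zero; suc; toℕ; fromℕ<; punchIn; combine; remQuot)
import Data.Fin.Properties as Fin
open import Data.Integer.Base using (+_; -[1+_]; 1ℤ; -1ℤ; _+_; _*_; -_; _-_; ≢-nonZero)
open import Data.Integer.Divisibility.Signed
  using (_∣_; divides; ∣⇒∣ᵤ; ∣-refl; ∣-trans; ∣m⇒∣m*n; ∣n⇒∣m*n; ∣m∣n⇒∣m+n; m∣∣m∣; 0∣⇒≡0)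
open import Data.Integer.DivMod using (_/_; _%_; n%d<d; a≡a%n+[a/n]*n)
open import Data.Integer.Properties hiding (≤-<-trans; ≤-trans; <⇒≤; ≤-reflexive)
open import Data.Integer.Tactic.RingSolver using (solve-∀)
open import Data.List.Base using ([]; map) renaming (_∷_ to _∷ₚ_)
open import Data.Nat.Base as ℕ using (ℕ; zero; suc; _<_; _≤_)
import Data.Nat.Divisibility as ℕ
open import Data.Nat.Induction using (<-wellFounded)
import Data.Nat.Properties as ℕ
open import Data.Product.Base using (Σ-syntax; _,_; proj₁; proj₂)
open import Data.Rational.Base as ℚ using (ℚ)
import Data.Rational.Properties as ℚ
import Data.Rational.Unnormalised.Base as ℚᵘ
import Data.Rational.Unnormalised.Properties as ℚᵘ
open import Data.Sum.Base using (inj₁; inj₂; _⊎_; [_,_]′)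
open import Data.Unit.Base using (tt)
open import Data.Vec.Functional using (Vector; _∷_; insertAt)
open import Data.Vec.Functional.Properties using (insertAt-lookup; insertAt-punchIn)
open import Function.Base using (_∘_)
open import Induction.WellFounded using (Acc; acc; WellFounded)
open import Level using (0ℓ)
open import Relation.Binary.PropositionalEquality
  using (_≡_; _≢_; _≗_; refl; sym; trans; cong; cong₂; subst; module ≡-Reasoning)
open import Relation.Nullary.Decidable using (yes; no; does; ¬?; decidable-stable)
open import Relation.Nullary.Negation using (¬_; contradiction)

-- Why the same `N` occurs twice. Since `B P z = P D W z`, the vector `P D y` lies in `𝓑𝓕[𝓛]`
-- exactly when `D y = D W z` for some `z` supported where `d` is nonzero, that is, when `y - W z`
-- is supported on the zeros of `d`. Such `y` are generated by the columns of `W` at the nonzero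
-- entries and the unit vectors at the others: the columns of `N`. In the pencil a zero of `d`
-- leaves a multiple of a unit vector, and at `t = 0` a nonzero entry leaves a multiple of a column
-- of `W`: again `N`, up to scaling by `d′`. So the order of `𝓡` and the leading coefficient share
-- the factor `det N`. The determinant is given only by expansion along row zero. Its
-- multiplicativity is itself drawn from the diagonal form, so the row operations leading there must
-- carry their own proof that they preserve determinants.

private
  ℤ-ring : CommutativeRing 0ℓ 0ℓ
  ℤ-ring = +-*-commutativeRing

open SemiringSum (CommutativeRing.semiring ℤ-ring)
  using (sum; sum-cong-≗; sum-remove; ∑-distrib-+; ∑-comm; *-distribˡ-sum; *-distribʳ-sum)
open CommutativeMonoidSum *-1-commutativeMonoid using () renaming (sum to product)
open Determinant (CommutativeRing.rawRing ℤ-ring)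
open RawSemiringDefs (RawRing.rawSemiring (CommutativeRing.rawRing ℤ-ring)) using (_^_)
open ℤMod using (apply; free; matrixHom)

private
  variable
    m n : ℕ

-- Sums and matrices over the integers

sum-zero : {f : Vector ℤ n} → (∀ i → f i ≡ 0ℤ) → sum f ≡ 0ℤ
sum-zero {zero}  f≡0 = refl
sum-zero {suc n} f≡0 = cong₂ _+_ (f≡0 zero) (sum-zero (f≡0 ∘ suc))

i+i≡0⇒i≡0 : ∀ i → i + i ≡ 0ℤ → i ≡ 0ℤ
i+i≡0⇒i≡0 i eq =
  *-cancelˡ-≡ (+ 2) i 0ℤ (trans (double i) eq)
  where
  double : ∀ i → + 2 * i ≡ i + i
  double = solve-∀

infixl 7 _⊗_
infix  8 _ᵀ
infix  4 _≋_
infixr 6 _⊕_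

-- A record rather than a bare function type, so that unification can read `A` and `B` off the type
-- of a proof.
record _≋_ {n} (A B : Matrix ℤ n) : Set where
  constructor entrywise
  field at : ∀ i j → A i j ≡ B i j

open _≋_

-- Opaque, so that the factors of a product can be inferred by unification.
opaque
  _⊗_ : Matrix ℤ n → Matrix ℤ n → Matrix ℤ n
  (A ⊗ B) i j = apply A (λ k → B k j) i

  ⊗-column : (A B : Matrix ℤ n) → ∀ i j → (A ⊗ B) i j ≡ apply A (λ k → B k j) i
  ⊗-column A B i j = refl

_ᵀ : Matrix ℤ n → Matrix ℤ n
(A ᵀ) i j = A j i

_⊕_ : ℤ → Matrix ℤ n → Matrix ℤ (suc n)
(a ⊕ M) zero    zero    = a
(a ⊕ M) zero    (suc j) = 0ℤ
(a ⊕ M) (suc i) zero    = 0ℤ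
(a ⊕ M) (suc i) (suc j) = M i j

diag : Vector ℤ n → Matrix ℤ n
diag {suc n} d = d zero ⊕ diag (d ∘ suc)

𝟙 : Matrix ℤ n
𝟙 = diag (λ _ → 1ℤ)

apply-cong : (A : Matrix ℤ n) {x y : Vector ℤ n} → x ≗ y → apply A x ≗ apply A y
apply-cong A x≗y i = sum-cong-≗ (λ j → cong (A i j *_) (x≗y j))

apply-congˡ : {A B : Matrix ℤ n} → A ≋ B → ∀ x → apply A x ≗ apply B x
apply-congˡ A≋B x i = sum-cong-≗ (λ j → cong (_* x j) (at A≋B i j))

opaque
  unfolding _⊗_

  apply-⊗ : (A B : Matrix ℤ n) (x : Vector ℤ n) → apply (A ⊗ B) x ≗ apply A (apply B x)
  apply-⊗ A B x i = begin
    sum (λ j → sum (λ k → A i k * B k j) * x j)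
      ≡⟨ sum-cong-≗ (λ j → *-distribʳ-sum (x j) (λ k → A i k * B k j)) ⟩
    sum (λ j → sum (λ k → A i k * B k j * x j))
      ≡⟨ ∑-comm (λ j k → A i k * B k j * x j) ⟩
    sum (λ k → sum (λ j → A i k * B k j * x j))
      ≡⟨ sum-cong-≗ (λ k → sum-cong-≗ (λ j → *-assoc (A i k) (B k j) (x j))) ⟩
    sum (λ k → sum (λ j → A i k * (B k j * x j)))
      ≡⟨ sum-cong-≗ (λ k → *-distribˡ-sum (A i k) (λ j → B k j * x j)) ⟨
    sum (λ k → A i k * apply B x k) ∎
    where open ≡-Reasoning

sum-diagˡ : (d x : Vector ℤ n) → ∀ i → sum (λ j → diag d i j * x j) ≡ d i * x i
sum-diagˡ d x zero = begin
  d zero * x zero + sum (λ j → 0ℤ * x (suc j))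
    ≡⟨ cong (λ z → d zero * x zero + z) (sum-zero {f = λ j → 0ℤ * x (suc j)} (λ j → *-zeroˡ (x (suc j)))) ⟩
  d zero * x zero + 0ℤ
    ≡⟨ +-identityʳ _ ⟩
  d zero * x zero ∎
  where open ≡-Reasoning
sum-diagˡ d x (suc i) = begin
  0ℤ * x zero + sum (λ j → diag (d ∘ suc) i j * x (suc j))
    ≡⟨ cong₂ _+_ (*-zeroˡ (x zero)) (sum-diagˡ (d ∘ suc) (x ∘ suc) i) ⟩
  0ℤ + d (suc i) * x (suc i)
    ≡⟨ +-identityˡ _ ⟩
  d (suc i) * x (suc i) ∎
  where open ≡-Reasoning

diag-sym : (d : Vector ℤ n) → diag d ᵀ ≋ diag d
diag-sym d .at zero    zero    = refl
diag-sym d .at zero    (suc j) = refl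
diag-sym d .at (suc i) zero    = refl
diag-sym d .at (suc i) (suc j) = diag-sym (d ∘ suc) .at i j

apply-𝟙 : (x : Vector ℤ n) → apply 𝟙 x ≗ x
apply-𝟙 x i = trans (sum-diagˡ (λ _ → 1ℤ) x i) (*-identityˡ (x i))

opaque
  unfolding _⊗_

  ⊗-diag : (A : Matrix ℤ n) (d : Vector ℤ n) → ∀ i j → (A ⊗ diag d) i j ≡ A i j * d j
  ⊗-diag A d i j = begin
    sum (λ k → A i k * diag d k j)  ≡⟨ sum-cong-≗ (λ k → *-comm (A i k) (diag d k j)) ⟩
    sum (λ k → diag d k j * A i k)  ≡⟨ sum-cong-≗ (λ k → cong (_* A i k) (diag-sym d .at j k)) ⟩
    sum (λ k → diag d j k * A i k)  ≡⟨ sum-diagˡ d (A i) j ⟩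
    d j * A i j                     ≡⟨ *-comm (d j) (A i j) ⟩
    A i j * d j                     ∎
    where open ≡-Reasoning

opaque
  unfolding _⊗_

  ⊗-cong : {A B C D : Matrix ℤ n} → A ≋ B → C ≋ D → A ⊗ C ≋ B ⊗ D
  ⊗-cong {A = A} {B} {C} {D} p q .at i j =
    trans (apply-congˡ p (λ k → C k j) i) (apply-cong B (λ k → at q k j) i)

  ⊗-assoc : (A B C : Matrix ℤ n) → A ⊗ B ⊗ C ≋ A ⊗ (B ⊗ C)
  ⊗-assoc A B C .at i j = apply-⊗ A B (λ k → C k j) i

  ⊗-identityˡ : (A : Matrix ℤ n) → 𝟙 ⊗ A ≋ A
  ⊗-identityˡ A .at i j = apply-𝟙 (λ k → A k j) i

  ⊗-identityʳ : (A : Matrix ℤ n) → A ⊗ 𝟙 ≋ A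
  ⊗-identityʳ A .at i j = trans (⊗-diag A (λ _ → 1ℤ) i j) (*-identityʳ (A i j))

matrixMonoid : ℕ → Monoid 0ℓ 0ℓ
matrixMonoid n = record
  { Carrier  = Matrix ℤ n
  ; _≈_      = _≋_
  ; _∙_      = _⊗_
  ; ε        = 𝟙
  ; isMonoid = record
    { isSemigroup = record
      { isMagma = record
        { isEquivalence = record
          { refl  = entrywise λ i j → refl
          ; sym   = λ p → entrywise λ i j → sym (at p i j)
          ; trans = λ p q → entrywise λ i j → trans (at p i j) (at q i j)
          }
        ; ∙-cong = ⊗-cong
        }
      ; assoc = ⊗-assoc
      }
    ; identity = ⊗-identityˡ , ⊗-identityʳ
    }
  }

module ≋ {n : ℕ} where
  open Monoid (matrixMonoid n) public hiding (_∙_; ε; _≈_; Carrier)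
  open MonoidProperties (matrixMonoid n) public using (cancelˡ; cancelʳ; cancelᶜ)

opaque
  unfolding _⊗_

  ᵀ-⊗ : (A B : Matrix ℤ n) → (A ⊗ B) ᵀ ≋ B ᵀ ⊗ A ᵀ
  ᵀ-⊗ A B .at i j = sum-cong-≗ (λ k → *-comm (A j k) (B k i))

  ⊕-⊗ : ∀ a (A : Matrix ℤ n) (M : Matrix ℤ (suc n)) i j →
        ((a ⊕ A) ⊗ M) (suc i) j ≡ apply A (λ k → M (suc k) j) i
  ⊕-⊗ a A M i j = trans (cong (_+ rest) (*-zeroˡ (M zero j))) (+-identityˡ rest)
    where
    rest : ℤ
    rest = apply A (λ k → M (suc k) j) i

  ⊕-⊗₀ : ∀ a (A : Matrix ℤ n) (M : Matrix ℤ (suc n)) j →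
         ((a ⊕ A) ⊗ M) zero j ≡ a * M zero j
  ⊕-⊗₀ a A M j =
    trans (cong (_+_ (a * M zero j)) (sum-zero {f = λ k → 0ℤ * M (suc k) j} (λ k → *-zeroˡ (M (suc k) j))))
          (+-identityʳ _)

⊕-cong : ∀ {a b} {A B : Matrix ℤ n} → a ≡ b → A ≋ B → a ⊕ A ≋ b ⊕ B
⊕-cong a≡b A≋B .at zero    zero    = a≡b
⊕-cong a≡b A≋B .at zero    (suc j) = refl
⊕-cong a≡b A≋B .at (suc i) zero    = refl
⊕-cong a≡b A≋B .at (suc i) (suc j) = at A≋B i j

⊕-ᵀ : ∀ a (A : Matrix ℤ n) → (a ⊕ A) ᵀ ≋ a ⊕ A ᵀ
⊕-ᵀ a A .at zero    zero    = refl
⊕-ᵀ a A .at zero    (suc j) = refl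
⊕-ᵀ a A .at (suc i) zero    = refl
⊕-ᵀ a A .at (suc i) (suc j) = refl

opaque
  unfolding _⊗_

  ⊕-⊗-⊕ : ∀ a b (A B : Matrix ℤ n) → (a ⊕ A) ⊗ (b ⊕ B) ≋ a * b ⊕ A ⊗ B
  ⊕-⊗-⊕ a b A B .at zero    zero    = ⊕-⊗₀ a A (b ⊕ B) zero
  ⊕-⊗-⊕ a b A B .at zero    (suc j) = trans (⊕-⊗₀ a A (b ⊕ B) (suc j)) (*-zeroʳ a)
  ⊕-⊗-⊕ a b A B .at (suc i) zero    =
    trans (⊕-⊗ a A (b ⊕ B) i zero) (sum-zero {f = λ k → A i k * 0ℤ} (λ k → *-zeroʳ (A i k)))
  ⊕-⊗-⊕ a b A B .at (suc i) (suc j) = ⊕-⊗ a A (b ⊕ B) i (suc j)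

-- Determinants

det-cong : {A B : Matrix ℤ n} → A ≋ B → det A ≡ det B
det-cong {zero}  A≋B = refl
det-cong {suc n} A≋B = sum-cong-≗ λ j →
  cong (_*_ (-1ℤ ^ toℕ j)) (cong₂ _*_ (at A≋B zero j) (det-cong (entrywise λ i k → at A≋B (suc i) (punchIn j k))))

-- The minors of the expansion do not involve row zero, so only its entries vary.
det-row₀ : ∀ c (a b : Vector ℤ (suc n)) (N : Fin n → Vector ℤ (suc n)) →
           det ((λ j → a j + c * b j) ∷ N) ≡ det (a ∷ N) + c * det (b ∷ N)
det-row₀ {n} c a b N = begin
  sum (λ j → s j * ((a j + c * b j) * D j))
    ≡⟨ sum-cong-≗ (λ j → distrib (s j) (a j) c (b j) (D j)) ⟩
  sum (λ j → s j * (a j * D j) + c * (s j * (b j * D j)))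
    ≡⟨ ∑-distrib-+ (λ j → s j * (a j * D j)) (λ j → c * (s j * (b j * D j))) ⟩
  det (a ∷ N) + sum (λ j → c * (s j * (b j * D j)))
    ≡⟨ cong (_+_ (det (a ∷ N))) (*-distribˡ-sum c (λ j → s j * (b j * D j))) ⟨
  det (a ∷ N) + c * det (b ∷ N) ∎
  where
  open ≡-Reasoning
  s D : Fin (suc n) → ℤ
  s j = -1ℤ ^ toℕ j
  D j = det (λ i k → N i (punchIn j k))
  distrib : ∀ s a c b D → s * ((a + c * b) * D) ≡ s * (a * D) + c * (s * (b * D))
  distrib = solve-∀

-- A term of the expansion along two rows, for the orders `a`, `b` and `b`, `a` at once. `R` stands
-- for the determinant of the other rows on the surviving columns; leaving it abstract lets the
-- induction drop a column.
swapTerm : (a b : Vector ℤ (suc (suc n))) (R : (Fin n → Fin (suc (suc n))) → ℤ) →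
           Fin (suc (suc n)) → Fin (suc n) → ℤ
swapTerm a b R j k =
  -1ℤ ^ toℕ j * -1ℤ ^ toℕ k * (a j * b (punchIn j k) + b j * a (punchIn j k)) *
  R (λ l → punchIn j (punchIn k l))

-- The terms (0 , k) and (suc k , 0) delete the same two columns in opposite orders,
-- hence cancel; what is left has the same shape with column 0 removed.
sum-swapTerm≡0 : (a b : Vector ℤ (suc (suc n))) (R : (Fin n → Fin (suc (suc n))) → ℤ) →
                 (∀ {φ ψ} → φ ≗ ψ → R φ ≡ R ψ) →
                 sum (λ j → sum (λ k → swapTerm a b R j k)) ≡ 0ℤ
sum-swapTerm≡0 {n} a b R R-cong = begin
  sum (f zero) + sum (λ j → f (suc j) zero + sum (λ k → f (suc j) (suc k)))
    ≡⟨ cong (_+_ (sum (f zero))) (∑-distrib-+ (λ j → f (suc j) zero) (λ j → sum (λ k → f (suc j) (suc k)))) ⟩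
  sum (f zero) + (sum (λ j → f (suc j) zero) + rest)
    ≡⟨ +-assoc (sum (f zero)) (sum (λ j → f (suc j) zero)) rest ⟨
  sum (f zero) + sum (λ j → f (suc j) zero) + rest
    ≡⟨ cong (_+ rest) (∑-distrib-+ (f zero) (λ j → f (suc j) zero)) ⟨
  sum (λ j → f zero j + f (suc j) zero) + rest
    ≡⟨ cong₂ _+_ (sum-zero {f = λ j → f zero j + f (suc j) zero} cancel) (rest≡0 a b R R-cong) ⟩
  0ℤ ∎
  where
  open ≡-Reasoning
  f : Fin (suc (suc n)) → Fin (suc n) → ℤ
  f = swapTerm a b R
  rest : ℤ
  rest = sum (λ j → sum (λ k → f (suc j) (suc k)))
  opposite : ∀ s x y y′ x′ r → 1ℤ * s * (x * y + y′ * x′) * r + -1ℤ * s * 1ℤ * (x′ * y′ + y * x) * r ≡ 0ℤ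
  opposite = solve-∀
  cancel : ∀ j → f zero j + f (suc j) zero ≡ 0ℤ
  cancel j = opposite (-1ℤ ^ toℕ j) (a zero) (b (suc j)) (b zero) (a (suc j)) (R (λ l → suc (punchIn j l)))
  signs : ∀ s t x r → -1ℤ * s * (-1ℤ * t) * x * r ≡ s * t * x * r
  signs = solve-∀
  rest≡0 : ∀ {n} (a b : Vector ℤ (suc (suc n))) (R : (Fin n → Fin (suc (suc n))) → ℤ) →
           (∀ {φ ψ} → φ ≗ ψ → R φ ≡ R ψ) →
           sum (λ j → sum (λ k → swapTerm a b R (suc j) (suc k))) ≡ 0ℤ
  rest≡0 {zero}  a b R R-cong = refl
  rest≡0 {suc n} a b R R-cong = trans
    (sum-cong-≗ (λ j → sum-cong-≗ (step j)))
    (sum-swapTerm≡0 (a ∘ suc) (b ∘ suc) R′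
      (λ {φ} {ψ} φ≗ψ → R-cong λ { zero → refl ; (suc l) → cong suc (φ≗ψ l) }))
    where
    -- Deleting two columns other than column zero leaves column zero in front.
    R′ : (Fin n → Fin (suc (suc n))) → ℤ
    R′ φ = R (zero ∷ (suc ∘ φ))
    step : ∀ j k → swapTerm a b R (suc j) (suc k) ≡ swapTerm (a ∘ suc) (b ∘ suc) R′ j k
    step j k = trans
      (signs (-1ℤ ^ toℕ j) (-1ℤ ^ toℕ k) p (R (λ l → punchIn (suc j) (punchIn (suc k) l))))
      (cong (_*_ (-1ℤ ^ toℕ j * -1ℤ ^ toℕ k * p))
            (R-cong {λ l → punchIn (suc j) (punchIn (suc k) l)} {zero ∷ (suc ∘ λ l → punchIn j (punchIn k l))}
                    λ { zero → refl ; (suc l) → refl }))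
      where
      p = a (suc j) * b (suc (punchIn j k)) + b (suc j) * a (suc (punchIn j k))

-- Stated as a vanishing sum, so that the two double expansions merge term by term into `swapTerm`.
det-swap : (a b : Vector ℤ (suc (suc n))) (N : Fin n → Vector ℤ (suc (suc n))) →
           det (a ∷ b ∷ N) + det (b ∷ a ∷ N) ≡ 0ℤ
det-swap {n} a b N = begin
  det (a ∷ b ∷ N) + det (b ∷ a ∷ N)
    ≡⟨ ∑-distrib-+ (λ j → s j * (a j * D b j)) (λ j → s j * (b j * D a j)) ⟨
  sum (λ j → s j * (a j * D b j) + s j * (b j * D a j))
    ≡⟨ sum-cong-≗ merge ⟩
  sum (λ j → sum (λ k → swapTerm a b R j k))
    ≡⟨ sum-swapTerm≡0 a b R (λ {φ} {ψ} φ≗ψ → det-cong {A = λ i l → N i (φ l)} {B = λ i l → N i (ψ l)} (entrywise λ i l → cong (N i) (φ≗ψ l))) ⟩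
  0ℤ ∎
  where
  open ≡-Reasoning
  R : (Fin n → Fin (suc (suc n))) → ℤ
  R φ = det (λ i l → N i (φ l))
  s : ∀ {n} → Fin n → ℤ
  s j = -1ℤ ^ toℕ j
  E : Fin (suc (suc n)) → Fin (suc n) → ℤ
  E j k = R (λ l → punchIn j (punchIn k l))
  D : Vector ℤ (suc (suc n)) → Fin (suc (suc n)) → ℤ
  D x j = sum (λ k → s k * (x (punchIn j k) * E j k))
  pull : ∀ s a t b e → s * (a * (t * (b * e))) ≡ s * a * (t * (b * e))
  pull = solve-∀
  addTerms : ∀ s t x y x′ y′ e → s * x * (t * (y * e)) + s * y′ * (t * (x′ * e)) ≡ s * t * (x * y + y′ * x′) * e
  addTerms = solve-∀
  merge : ∀ j → s j * (a j * D b j) + s j * (b j * D a j) ≡ sum (λ k → swapTerm a b R j k)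
  merge j = begin
    s j * (a j * D b j) + s j * (b j * D a j)
      ≡⟨ cong₂ _+_ (*-assoc (s j) (a j) (D b j)) (*-assoc (s j) (b j) (D a j)) ⟨
    s j * a j * D b j + s j * b j * D a j
      ≡⟨ cong₂ _+_ (*-distribˡ-sum (s j * a j) (λ k → s k * (b (punchIn j k) * E j k)))
                  (*-distribˡ-sum (s j * b j) (λ k → s k * (a (punchIn j k) * E j k))) ⟩
    sum (λ k → s j * a j * (s k * (b (punchIn j k) * E j k))) +
    sum (λ k → s j * b j * (s k * (a (punchIn j k) * E j k)))
      ≡⟨ ∑-distrib-+ (λ k → s j * a j * (s k * (b (punchIn j k) * E j k)))
                       (λ k → s j * b j * (s k * (a (punchIn j k) * E j k))) ⟨
    sum (λ k → s j * a j * (s k * (b (punchIn j k) * E j k)) +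
               s j * b j * (s k * (a (punchIn j k) * E j k)))
      ≡⟨ sum-cong-≗ (λ k → addTerms (s j) (s k) (a j) (b (punchIn j k)) (a (punchIn j k)) (b j) (E j k)) ⟩
    sum (λ k → swapTerm a b R j k) ∎

det-repeated : (a : Vector ℤ (suc (suc n))) (N : Fin n → Vector ℤ (suc (suc n))) → det (a ∷ a ∷ N) ≡ 0ℤ
det-repeated a N = i+i≡0⇒i≡0 _ (det-swap a a N)

opaque
  unfolding _⊗_

  det-diag-⊗ : (d : Vector ℤ n) (M : Matrix ℤ n) → det (diag d ⊗ M) ≡ product d * det M
  det-diag-⊗ {zero}  d M = refl
  det-diag-⊗ {suc n} d M = begin
    sum (λ j → s j * ((diag d ⊗ M) zero j * det (minor (diag d ⊗ M) j)))
      ≡⟨ sum-cong-≗ (λ j → cong (_*_ (s j)) (cong₂ _*_ (sum-diagˡ d (λ k → M k j) zero) (minors j))) ⟩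
    sum (λ j → s j * (d zero * M zero j * (p * det (minor M j))))
      ≡⟨ sum-cong-≗ (λ j → pull (s j) (d zero) (M zero j) p (det (minor M j))) ⟩
    sum (λ j → d zero * p * (s j * (M zero j * det (minor M j))))
      ≡⟨ *-distribˡ-sum (d zero * p) (λ j → s j * (M zero j * det (minor M j))) ⟨
    d zero * p * det M ∎
    where
    open ≡-Reasoning
    s : Fin (suc n) → ℤ
    s j = -1ℤ ^ toℕ j
    p : ℤ
    p = product (d ∘ suc)
    minors : ∀ j → det (minor (diag d ⊗ M) j) ≡ p * det (minor M j)
    minors j = trans (det-cong {A = minor (diag d ⊗ M) j} {B = diag (d ∘ suc) ⊗ minor M j} (entrywise λ i k → ⊕-⊗ (d zero) (diag (d ∘ suc)) M i (punchIn j k)))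
                     (det-diag-⊗ (d ∘ suc) (minor M j))
    pull : ∀ s d m p D → s * (d * m * (p * D)) ≡ d * p * (s * (m * D))
    pull = solve-∀

det-𝟙 : ∀ n → det (𝟙 {n}) ≡ 1ℤ
det-𝟙 zero    = refl
det-𝟙 (suc n) = cong₂ _+_
  (trans (*-identityˡ (1ℤ * det (minor (𝟙 {suc n}) zero))) (trans (*-identityˡ (det (𝟙 {n}))) (det-𝟙 n)))
  (sum-zero {f = λ j → -1ℤ ^ toℕ (suc j) * (0ℤ * det (minor (𝟙 {suc n}) (suc j)))} (λ j → *-zeroʳ (-1ℤ ^ toℕ (suc j))))

-- Unimodular matrices

-- The determinant fields stand in for multiplicativity, which is proved only later from
-- diagonalisation. The transposed one makes the type closed under transposition, hence available
-- for column operations.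
record SL (n : ℕ) : Set where
  field
    mat inv    : Matrix ℤ n
    mat⊗inv    : mat ⊗ inv ≋ 𝟙
    inv⊗mat    : inv ⊗ mat ≋ 𝟙
    det-mat⊗   : ∀ M → det (mat ⊗ M) ≡ det M
    det-matᵀ⊗  : ∀ M → det (mat ᵀ ⊗ M) ≡ det M

open SL

private
  ᵀ-inverse : {A B : Matrix ℤ n} → A ⊗ B ≋ 𝟙 → B ᵀ ⊗ A ᵀ ≋ 𝟙
  ᵀ-inverse {A = A} {B} AB≋𝟙 .at i j =
    trans (sym (ᵀ-⊗ A B .at i j)) (trans (at AB≋𝟙 j i) (diag-sym (λ _ → 1ℤ) .at i j))

  det-inverse⊗ : {A B : Matrix ℤ n} → A ⊗ B ≋ 𝟙 → (∀ M → det (A ⊗ M) ≡ det M) →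
                 ∀ M → det (B ⊗ M) ≡ det M
  det-inverse⊗ {A = A} {B} AB≋𝟙 det-A⊗ M =
    trans (sym (det-A⊗ (B ⊗ M))) (det-cong (≋.cancelˡ AB≋𝟙 M))

opaque
  unfolding _⊗_

  -- Row zero is kept, and each minor of the product is `A` times the minor of `M`.
  det-lift : {A : Matrix ℤ n} → (∀ M → det (A ⊗ M) ≡ det M) → ∀ M → det ((1ℤ ⊕ A) ⊗ M) ≡ det M
  det-lift {n} {A} det-A⊗ M = sum-cong-≗ λ j → cong (_*_ (-1ℤ ^ toℕ j)) (cong₂ _*_
    (trans (⊕-⊗₀ 1ℤ A M j) (*-identityˡ (M zero j)))
    (trans (det-cong {A = minor ((1ℤ ⊕ A) ⊗ M) j} {B = A ⊗ minor M j}
              (entrywise λ i k → ⊕-⊗ 1ℤ A M i (punchIn j k)))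
           (det-A⊗ (minor M j))))

SL-id : SL n
SL-id = record
  { mat       = 𝟙
  ; inv       = 𝟙
  ; mat⊗inv   = ≋.identityˡ 𝟙
  ; inv⊗mat   = ≋.identityˡ 𝟙
  ; det-mat⊗  = λ M → det-cong (≋.identityˡ M)
  ; det-matᵀ⊗ = λ M → det-cong (≋.trans (≋.∙-congʳ (diag-sym (λ _ → 1ℤ))) (≋.identityˡ M))
  }

infixl 7 _∘SL_

_∘SL_ : SL n → SL n → SL n
P ∘SL Q = record
  { mat       = mat P ⊗ mat Q
  ; inv       = inv Q ⊗ inv P
  ; mat⊗inv   = ≋.trans (≋.cancelᶜ (mat⊗inv Q) (mat P) (inv P)) (mat⊗inv P)
  ; inv⊗mat   = ≋.trans (≋.cancelᶜ (inv⊗mat P) (inv Q) (mat Q)) (inv⊗mat Q)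
  ; det-mat⊗  = λ M → trans (det-cong (≋.assoc (mat P) (mat Q) M))
                            (trans (det-mat⊗ P (mat Q ⊗ M)) (det-mat⊗ Q M))
  ; det-matᵀ⊗ = λ M → trans (det-cong (≋.trans (≋.∙-congʳ (ᵀ-⊗ (mat P) (mat Q)))
                                               (≋.assoc (mat Q ᵀ) (mat P ᵀ) M)))
                            (trans (det-matᵀ⊗ Q (mat P ᵀ ⊗ M)) (det-matᵀ⊗ P M))
  }

_⁻¹SL : SL n → SL n
P ⁻¹SL = record
  { mat       = inv P
  ; inv       = mat P
  ; mat⊗inv   = inv⊗mat P
  ; inv⊗mat   = mat⊗inv P
  ; det-mat⊗  = det-inverse⊗ (mat⊗inv P) (det-mat⊗ P)
  ; det-matᵀ⊗ = det-inverse⊗ (ᵀ-inverse (inv⊗mat P)) (det-matᵀ⊗ P)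
  }

_ᵀSL : SL n → SL n
P ᵀSL = record
  { mat       = mat P ᵀ
  ; inv       = inv P ᵀ
  ; mat⊗inv   = ᵀ-inverse (inv⊗mat P)
  ; inv⊗mat   = ᵀ-inverse (mat⊗inv P)
  ; det-mat⊗  = det-matᵀ⊗ P
  ; det-matᵀ⊗ = det-mat⊗ P
  }

SL-lift : SL n → SL (suc n)
SL-lift P = record
  { mat       = 1ℤ ⊕ mat P
  ; inv       = 1ℤ ⊕ inv P
  ; mat⊗inv   = ≋.trans (⊕-⊗-⊕ 1ℤ 1ℤ (mat P) (inv P)) (⊕-cong refl (mat⊗inv P))
  ; inv⊗mat   = ≋.trans (⊕-⊗-⊕ 1ℤ 1ℤ (inv P) (mat P)) (⊕-cong refl (inv⊗mat P))
  ; det-mat⊗  = det-lift (det-mat⊗ P)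
  ; det-matᵀ⊗ = λ M → trans (det-cong (≋.∙-congʳ (⊕-ᵀ 1ℤ (mat P)))) (det-lift (det-matᵀ⊗ P) M)
  }

-- The shear adding `c` times row one to row zero. It, its transpose and their lifts are the only
-- elementary operations; a row swap has determinant -1, and a rotation composed of shears replaces
-- it.
up : ℤ → Matrix ℤ (suc (suc n))
up c zero    = 1ℤ ∷ c ∷ λ _ → 0ℤ
up c (suc i) = 𝟙 (suc i)

opaque
  unfolding _⊗_

  up-⊗₀ : ∀ c (M : Matrix ℤ (suc (suc n))) j → (up c ⊗ M) zero j ≡ M zero j + c * M (suc zero) j
  up-⊗₀ {n} c M j = begin
    1ℤ * M zero j + (c * M (suc zero) j + sum zeros)
      ≡⟨ cong (λ z → 1ℤ * M zero j + (c * M (suc zero) j + z)) (sum-zero {f = zeros} (λ k → *-zeroˡ (M (suc (suc k)) j))) ⟩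
    1ℤ * M zero j + (c * M (suc zero) j + 0ℤ)
      ≡⟨ cong₂ _+_ (*-identityˡ (M zero j)) (+-identityʳ (c * M (suc zero) j)) ⟩
    M zero j + c * M (suc zero) j ∎
    where
    open ≡-Reasoning
    zeros : Vector ℤ n
    zeros k = 0ℤ * M (suc (suc k)) j

  up-⊗ : ∀ c (M : Matrix ℤ (suc (suc n))) i j → (up c ⊗ M) (suc i) j ≡ M (suc i) j
  up-⊗ c M i = ≋.identityˡ M .at (suc i)

  upᵀ-⊗ : ∀ c (M : Matrix ℤ (suc (suc n))) i j →
          (up c ᵀ ⊗ M) i j ≡ M i j + (0ℤ ∷ c ∷ λ _ → 0ℤ) i * M zero j
  upᵀ-⊗ {n} c M i j = trans (cong (_+_ (up c zero i * M zero j)) (rest i)) (split i)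
    where
    tail₀ : Fin (suc (suc n)) → ℤ
    tail₀ zero    = 0ℤ
    tail₀ (suc i) = M (suc i) j
    rest : ∀ i → sum (λ k → 𝟙 (suc k) i * M (suc k) j) ≡ tail₀ i
    rest zero    = sum-zero {f = λ k → 0ℤ * M (suc k) j} (λ k → *-zeroˡ (M (suc k) j))
    rest (suc i) = trans (sum-cong-≗ (λ k → cong (_* M (suc k) j) (diag-sym (λ _ → 1ℤ) .at i k)))
                         (apply-𝟙 (λ k → M (suc k) j) i)
    row₀ : ∀ x → 1ℤ * x + 0ℤ ≡ x + 0ℤ * x
    row₀ = solve-∀
    split : ∀ i → up c zero i * M zero j + tail₀ i ≡ M i j + (0ℤ ∷ c ∷ λ _ → 0ℤ) i * M zero j
    split zero          = row₀ (M zero j)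
    split (suc zero)    = +-comm (c * M zero j) (M (suc zero) j)
    split (suc (suc i)) = +-comm (0ℤ * M zero j) (M (suc (suc i)) j)

private
  up-inverse : ∀ {n} c → up {n} c ⊗ up (- c) ≋ 𝟙
  up-inverse c .at zero    zero          = trans (up-⊗₀ c (up (- c)) zero) (cong (_+_ 1ℤ) (*-zeroʳ c))
  up-inverse c .at zero    (suc zero)    = trans (up-⊗₀ c (up (- c)) (suc zero))
    (trans (cong (_+_ (- c)) (*-identityʳ c)) (+-inverseˡ c))
  up-inverse c .at zero    (suc (suc j)) = trans (up-⊗₀ c (up (- c)) (suc (suc j)))
    (trans (+-identityˡ (c * 0ℤ)) (*-zeroʳ c))
  up-inverse c .at (suc i) j             = up-⊗ c (up (- c)) i j

  det-up : ∀ c (M : Matrix ℤ (suc (suc n))) → det (up c ⊗ M) ≡ det M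
  det-up {n} c M = begin
    det (up c ⊗ M)
      ≡⟨ det-cong {A = up c ⊗ M} {B = (λ j → x j + c * y j) ∷ y ∷ N}
                  (entrywise λ { zero j → up-⊗₀ c M j ; (suc zero) j → up-⊗ c M zero j
                     ; (suc (suc i)) j → up-⊗ c M (suc i) j }) ⟩
    det ((λ j → x j + c * y j) ∷ y ∷ N)
      ≡⟨ det-row₀ c x y (y ∷ N) ⟩
    det (x ∷ y ∷ N) + c * det (y ∷ y ∷ N)
      ≡⟨ cong₂ (λ p q → p + c * q) (det-cong {A = x ∷ y ∷ N} {B = M} (entrywise λ { zero j → refl ; (suc zero) j → refl ; (suc (suc i)) j → refl }))
               (det-repeated y N) ⟩
    det M + c * 0ℤ
      ≡⟨ cong (_+_ (det M)) (*-zeroʳ c) ⟩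
    det M + 0ℤ
      ≡⟨ +-identityʳ _ ⟩
    det M ∎
    where
    open ≡-Reasoning
    x = M zero
    y = M (suc zero)
    N : Fin n → Vector ℤ (suc (suc n))
    N i = M (suc (suc i))

  -- This shear alters row one, while linearity is at hand only for row zero. The determinants
  -- before and after are therefore both compared with that of `z ∷ x ∷ N`, of which each is the
  -- negative.
  det-upᵀ : ∀ c (M : Matrix ℤ (suc (suc n))) → det (up c ᵀ ⊗ M) ≡ det M
  det-upᵀ {n} c M = begin
    det (up c ᵀ ⊗ M)
      ≡⟨ det-cong {A = up c ᵀ ⊗ M} {B = x ∷ z ∷ N}
                  (entrywise λ { zero j → trans (upᵀ-⊗ c M zero j) (+-identityʳ (x j))
                     ; (suc zero) j → upᵀ-⊗ c M (suc zero) j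
                     ; (suc (suc i)) j → trans (upᵀ-⊗ c M (suc (suc i)) j) (+-identityʳ (N i j)) }) ⟩
    det (x ∷ z ∷ N)
      ≡⟨ +-cancelʳ (det (x ∷ z ∷ N)) (det (x ∷ y ∷ N)) (det (z ∷ x ∷ N)) (trans (det-swap x z N) (sym det-swap′)) ⟩
    det (x ∷ y ∷ N)
      ≡⟨ det-cong {A = x ∷ y ∷ N} {B = M} (entrywise λ { zero j → refl ; (suc zero) j → refl ; (suc (suc i)) j → refl }) ⟩
    det M ∎
    where
    open ≡-Reasoning
    x = M zero
    y = M (suc zero)
    z : Vector ℤ (suc (suc n))
    z j = y j + c * x j
    N : Fin n → Vector ℤ (suc (suc n))
    N i = M (suc (suc i))
    +-cancelʳ : ∀ p q r → p + r ≡ q + r → p ≡ q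
    +-cancelʳ p q r eq = trans (sym (undo p r)) (trans (cong (_- r) eq) (undo q r))
      where
      undo : ∀ p r → p + r - r ≡ p
      undo = solve-∀
    det-swap′ : det (x ∷ y ∷ N) + det (z ∷ x ∷ N) ≡ 0ℤ
    det-swap′ = begin
      det (x ∷ y ∷ N) + det (z ∷ x ∷ N)
        ≡⟨ cong (_+_ (det (x ∷ y ∷ N))) (det-row₀ c y x (x ∷ N)) ⟩
      det (x ∷ y ∷ N) + (det (y ∷ x ∷ N) + c * det (x ∷ x ∷ N))
        ≡⟨ cong (λ q → det (x ∷ y ∷ N) + (det (y ∷ x ∷ N) + c * q)) (det-repeated x N) ⟩
      det (x ∷ y ∷ N) + (det (y ∷ x ∷ N) + c * 0ℤ)
        ≡⟨ cong (λ q → det (x ∷ y ∷ N) + (det (y ∷ x ∷ N) + q)) (*-zeroʳ c) ⟩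
      det (x ∷ y ∷ N) + (det (y ∷ x ∷ N) + 0ℤ)
        ≡⟨ cong (_+_ (det (x ∷ y ∷ N))) (+-identityʳ _) ⟩
      det (x ∷ y ∷ N) + det (y ∷ x ∷ N)
        ≡⟨ det-swap x y N ⟩
      0ℤ ∎

SL-up : ℤ → SL (suc (suc n))
SL-up c = record
  { mat       = up c
  ; inv       = up (- c)
  ; mat⊗inv   = up-inverse c
  ; inv⊗mat   = ≋.trans (≋.reflexive (cong (λ z → up (- c) ⊗ up z) (sym (neg-involutive c)))) (up-inverse (- c))
  ; det-mat⊗  = det-up c
  ; det-matᵀ⊗ = det-upᵀ c
  }

SL-down : ℤ → SL (suc (suc n))
SL-down c = SL-up c ᵀSL

-- Diagonalisation

0s : Vector ℤ n
0s _ = 0ℤ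

∷-0s : ∀ a → a ∷ 0ℤ ∷ 0s {n} ≗ a ∷ 0s
∷-0s a zero          = refl
∷-0s a (suc zero)    = refl
∷-0s a (suc (suc i)) = refl

apply-up : ∀ c (a b : ℤ) → apply (up c) (a ∷ b ∷ 0s {n}) ≗ a + c * b ∷ b ∷ 0s
apply-up c a b i = trans (sym (⊗-column (up c) columns i zero)) (entry i)
  where
  -- The vector becomes a matrix with all columns equal, so that the lemmas on products apply.
  columns : Matrix ℤ _
  columns k _ = (a ∷ b ∷ 0s) k
  entry : ∀ i → (up c ⊗ columns) i zero ≡ (a + c * b ∷ b ∷ 0s) i
  entry zero          = up-⊗₀ c columns zero
  entry (suc zero)    = up-⊗ c columns zero zero
  entry (suc (suc i)) = up-⊗ c columns (suc i) zero

apply-down : ∀ c (a b : ℤ) → apply (up c ᵀ) (a ∷ b ∷ 0s {n}) ≗ a ∷ b + c * a ∷ 0s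
apply-down c a b i = trans (sym (⊗-column (up c ᵀ) columns i zero)) (trans (upᵀ-⊗ c columns i zero) (entry i))
  where
  columns : Matrix ℤ _
  columns k _ = (a ∷ b ∷ 0s) k
  entry : ∀ i → columns i zero + (0ℤ ∷ c ∷ 0s) i * a ≡ (a ∷ b + c * a ∷ 0s) i
  entry zero          = +-identityʳ a
  entry (suc zero)    = refl
  entry (suc (suc i)) = refl

apply-lift : (A : Matrix ℤ n) (v : Vector ℤ (suc n)) → apply (1ℤ ⊕ A) v ≗ v zero ∷ apply A (v ∘ suc)
apply-lift A v i = trans (sym (⊗-column (1ℤ ⊕ A) columns i zero)) (entry i)
  where
  columns : Matrix ℤ _
  columns k _ = v k
  entry : ∀ i → ((1ℤ ⊕ A) ⊗ columns) i zero ≡ (v zero ∷ apply A (v ∘ suc)) i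
  entry zero    = trans (⊕-⊗₀ 1ℤ A columns zero) (*-identityˡ (v zero))
  entry (suc i) = ⊕-⊗ 1ℤ A columns i zero

apply-∘SL : (P Q : SL n) (x y : Vector ℤ n) {z : Vector ℤ n} →
            apply (mat Q) x ≗ y → apply (mat P) y ≗ z → apply (mat (P ∘SL Q)) x ≗ z
apply-∘SL P Q x y Qx≗y Py≗z i =
  trans (apply-⊗ (mat P) (mat Q) x i) (trans (apply-cong (mat P) Qx≗y i) (Py≗z i))

-- What the descent of pivots consumes is the bound on `∣ d ∣`. It fails for `b ≡ 0ℤ`, where the
-- pair is already reduced and `d` is `a`, possibly zero; hence the alternative.
euclid : ∀ a b → Acc _<_ ∣ b ∣ →
         ∃[ d ] Σ[ P ∈ SL (suc (suc n)) ]
           apply (mat P) (a ∷ b ∷ 0s) ≗ d ∷ 0s ×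
           (b ≡ 0ℤ × d ≡ a ⊎ d ≢ 0ℤ × ∣ d ∣ ≤ ∣ b ∣)
euclid a b (acc rs) with b ≟ 0ℤ
... | yes refl = a , SL-id ,
  (λ i → trans (apply-𝟙 (a ∷ 0ℤ ∷ 0s) i)
               (∷-0s a i)) ,
  inj₁ (refl , refl)
... | no b≢0 = d , P ∘SL step , apply-∘SL P step (a ∷ b ∷ 0s) (b ∷ - r ∷ 0s) stepped reduced , inj₂ (bound spec)
  where
  instance
    _ = ≢-nonZero b≢0
  q r : ℤ
  q = a / b
  r = + (a % b)
  ∣r∣<∣b∣ : ∣ - r ∣ < ∣ b ∣
  ∣r∣<∣b∣ = ℕ.≤-<-trans (ℕ.≤-reflexive (∣-i∣≡∣i∣ r)) (n%d<d a b)
  -- up 1 ∘ down -1 ∘ up 1 is the rotation (x , y) ↦ (y , - x).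
  step : SL (suc (suc _))
  step = SL-up 1ℤ ∘SL (SL-down -1ℤ ∘SL SL-up (1ℤ - q))
  pair-cong : ∀ {x y x′ y′} → x ≡ x′ → y ≡ y′ → x ∷ y ∷ 0s {n} ≗ x′ ∷ y′ ∷ 0s
  pair-cong refl refl _ = refl
  -- The shear by `- q`, taking `a` to its remainder, is merged with the first shear of the rotation
  -- into one by `1ℤ - q`.
  e₁ : a + (1ℤ - q) * b ≡ r + b
  e₁ = trans (cong (_+ (1ℤ - q) * b) (a≡a%n+[a/n]*n a b)) (lemma r q b)
    where
    lemma : ∀ r q b → r + q * b + (1ℤ - q) * b ≡ r + b
    lemma = solve-∀
  e₂ : ∀ r b → b + -1ℤ * (r + b) ≡ - r
  e₂ = solve-∀
  e₃ : ∀ r b → r + b + 1ℤ * - r ≡ b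
  e₃ = solve-∀
  stepped : apply (mat step) (a ∷ b ∷ 0s) ≗ b ∷ - r ∷ 0s
  stepped =
    apply-∘SL (SL-up 1ℤ) (SL-down -1ℤ ∘SL SL-up (1ℤ - q)) (a ∷ b ∷ 0s) (r + b ∷ - r ∷ 0s)
      (apply-∘SL (SL-down -1ℤ) (SL-up (1ℤ - q)) (a ∷ b ∷ 0s) (r + b ∷ b ∷ 0s)
        (λ i → trans (apply-up (1ℤ - q) a b i) (pair-cong e₁ refl i))
        (λ i → trans (apply-down -1ℤ (r + b) b i) (pair-cong refl (e₂ r b) i)))
      (λ i → trans (apply-up 1ℤ (r + b) (- r) i) (pair-cong (e₃ r b) refl i))
  rec = euclid b (- r) (rs ∣r∣<∣b∣)
  d = proj₁ rec
  P = proj₁ (proj₂ rec)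
  reduced = proj₁ (proj₂ (proj₂ rec))
  spec = proj₂ (proj₂ (proj₂ rec))
  bound : - r ≡ 0ℤ × d ≡ b ⊎ d ≢ 0ℤ × ∣ d ∣ ≤ ∣ - r ∣ → d ≢ 0ℤ × ∣ d ∣ ≤ ∣ b ∣
  bound (inj₁ (_ , d≡b))   = (λ d≡0 → b≢0 (trans (sym d≡b) d≡0)) , ℕ.≤-reflexive (cong ∣_∣ d≡b)
  bound (inj₂ (d≢0 , d≤r)) = d≢0 , ℕ.<⇒≤ (ℕ.≤-<-trans d≤r ∣r∣<∣b∣)

infix 4 _≺_

-- Zero is placed on top: trading a zero pivot for a nonzero one counts as progress, and can happen
-- only once in a descent.
_≺_ : ℤ → ℤ → Set
d ≺ a = d ≢ 0ℤ × (a ≡ 0ℤ ⊎ ∣ d ∣ < ∣ a ∣)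

≺-wellFounded : WellFounded _≺_
≺-wellFounded a = acc λ {d} (d≢0 , _) → nonZero d d≢0 (<-wellFounded ∣ d ∣)
  where
  nonZero : ∀ a → a ≢ 0ℤ → Acc _<_ ∣ a ∣ → Acc _≺_ a
  nonZero a a≢0 (acc rs) = acc λ where
    (_   , inj₁ a≡0) → contradiction a≡0 a≢0
    (d≢0 , inj₂ d<a) → nonZero _ d≢0 (rs d<a)

-- Row zero of `mat P ⊗ M` is then that of `M`, so a row that is already clear stays clear.
FixesRow₀ : SL (suc n) → Set
FixesRow₀ P = ∀ j → mat P zero j ≡ 𝟙 zero j

FixesRow₀-⊗ : (P : SL (suc n)) → FixesRow₀ P → ∀ M j → (mat P ⊗ M) zero j ≡ M zero j
FixesRow₀-⊗ P fixes M j = begin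
  (mat P ⊗ M) zero j               ≡⟨ ⊗-column (mat P) M zero j ⟩
  apply (mat P) (λ k → M k j) zero ≡⟨ sum-cong-≗ (λ k → cong (_* M k j) (fixes k)) ⟩
  apply 𝟙 (λ k → M k j) zero       ≡⟨ apply-𝟙 (λ k → M k j) zero ⟩
  M zero j                         ∎
  where open ≡-Reasoning

-- The alternative guarantees termination: an operation that disturbs row zero has to be paid for by
-- a smaller pivot.
ReducesTo : SL (suc n) → Vector ℤ (suc n) → ℤ → Set
ReducesTo P v d = apply (mat P) v ≗ d ∷ 0s × (FixesRow₀ P ⊎ d ≺ v zero)

-- For nonzero `a` dividing `b`, one shear clears the second entry without touching row zero.
-- Otherwise the remainder is nonzero, and Euclid applied to `a` and the remainder yields a pivot no
-- larger than the remainder, hence smaller than `a`.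
reducePair : ∀ a b → ∃[ d ] Σ[ P ∈ SL (suc (suc n)) ] ReducesTo P (a ∷ b ∷ 0s) d
reducePair a b with a ≟ 0ℤ | b ≟ 0ℤ
... | yes refl | yes refl = 0ℤ , SL-id ,
  (λ i → trans (apply-𝟙 (0ℤ ∷ 0ℤ ∷ 0s) i)
               (∷-0s 0ℤ i)) ,
  inj₁ (λ j → refl)
... | yes refl | no b≢0 with euclid 0ℤ b (<-wellFounded ∣ b ∣)
...   | _ , _ , _  , inj₁ (b≡0 , _) = contradiction b≡0 b≢0
...   | d , P , eq , inj₂ (d≢0 , _) = d , P , eq , inj₂ (d≢0 , inj₁ refl)
reducePair {n} a b | no a≢0 | _ = result (b % a) refl
  where
  instance
    _ = ≢-nonZero a≢0
  q : ℤ
  q = b / a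
  e : ∀ {r} → b % a ≡ r → b + - q * a ≡ + r
  e refl = trans (cong (_+ - q * a) (a≡a%n+[a/n]*n b a)) (lemma (+ (b % a)) q a)
    where
    lemma : ∀ r q a → r + q * a + - q * a ≡ r
    lemma = solve-∀
  stepped : ∀ {r} → b % a ≡ r → apply (up (- q) ᵀ) (a ∷ b ∷ 0s {n}) ≗ a ∷ + r ∷ 0s
  stepped eq i = trans (apply-down (- q) a b i) (cong (λ z → (a ∷ z ∷ 0s) i) (e eq))
  result : ∀ r → b % a ≡ r → ∃[ d ] Σ[ P ∈ SL (suc (suc n)) ] ReducesTo P (a ∷ b ∷ 0s) d
  result zero    eq = a , SL-down (- q) ,
    (λ i → trans (stepped eq i) (∷-0s a i)) ,
    inj₁ λ { zero → refl ; (suc zero) → refl ; (suc (suc _)) → refl }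
  result (suc r) eq = finish (euclid a (+ suc r) (<-wellFounded (suc r)))
    where
    finish : ∃[ d ] Σ[ P ∈ SL (suc (suc n)) ]
               apply (mat P) (a ∷ + suc r ∷ 0s) ≗ d ∷ 0s ×
               (+ suc r ≡ 0ℤ × d ≡ a ⊎ d ≢ 0ℤ × ∣ d ∣ ≤ suc r) →
             ∃[ d ] Σ[ P ∈ SL (suc (suc n)) ] ReducesTo P (a ∷ b ∷ 0s) d
    finish (_ , _ , _ , inj₁ (() , _))
    finish (d , P , reduced , inj₂ (d≢0 , d≤r)) =
      d , P ∘SL SL-down (- q) ,
      apply-∘SL P (SL-down (- q)) (a ∷ b ∷ 0s) (a ∷ + suc r ∷ 0s) (stepped eq) reduced ,
      inj₂ (d≢0 , inj₂ (ℕ.≤-<-trans d≤r (subst (_< ∣ a ∣) eq (n%d<d b a))))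

-- The tail is reduced through a lift, which fixes row zero whatever happens inside it; the outcome
-- is thus decided by the final pair alone.
reduce : (v : Vector ℤ (suc n)) → ∃[ d ] Σ[ P ∈ SL (suc n) ] ReducesTo P v d
reduce {zero}  v = v zero , SL-id ,
  (λ i → trans (apply-𝟙 v i) (single i)) , inj₁ (λ j → refl)
  where
  single : v ≗ v zero ∷ 0s
  single zero = refl
reduce {suc n} v with reduce (v ∘ suc)
... | d′ , P′ , reduced′ , _ with reducePair {n} (v zero) d′
...   | d , P , reduced , outcome =
  d , P ∘SL SL-lift P′ , apply-∘SL P (SL-lift P′) v (v zero ∷ d′ ∷ 0s) lifted reduced , total outcome
  where
  lifted : apply (mat (SL-lift P′)) v ≗ v zero ∷ d′ ∷ 0s
  lifted i = trans (apply-lift (mat P′) v i) (entry i)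
    where
    entry : v zero ∷ apply (mat P′) (v ∘ suc) ≗ v zero ∷ d′ ∷ 0s
    entry zero          = refl
    entry (suc zero)    = reduced′ zero
    entry (suc (suc i)) = reduced′ (suc i)
  row₀ : ∀ j → (1ℤ ⊕ mat P′) zero j ≡ 𝟙 zero j
  row₀ zero    = refl
  row₀ (suc j) = refl
  total : FixesRow₀ P ⊎ d ≺ v zero → FixesRow₀ (P ∘SL SL-lift P′) ⊎ d ≺ v zero
  total (inj₁ fixes) = inj₁ λ j →
    trans (FixesRow₀-⊗ P fixes (1ℤ ⊕ mat P′) j) (row₀ j)
  total (inj₂ d≺v₀)  = inj₂ d≺v₀

infix 4 _∼_

record _∼_ {n} (M N : Matrix ℤ n) : Set where
  field
    left right : SL n
    factors    : M ≋ mat left ⊗ N ⊗ mat right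

open _∼_

≋⇒∼ : {M N : Matrix ℤ n} → M ≋ N → M ∼ N
≋⇒∼ {N = N} M≋N = record
  { left    = SL-id
  ; right   = SL-id
  ; factors = ≋.trans M≋N (≋.sym (≋.trans (≋.identityʳ (𝟙 ⊗ N)) (≋.identityˡ N)))
  }

∼-trans : {L M N : Matrix ℤ n} → L ∼ M → M ∼ N → L ∼ N
∼-trans {N = N} L∼M M∼N = record
  { left    = left L∼M ∘SL left M∼N
  ; right   = right M∼N ∘SL right L∼M
  ; factors = ≋.trans (factors L∼M)
      (≋.trans (≋.∙-congʳ (≋.trans (≋.∙-congˡ (factors M∼N)) (≋.sym (≋.assoc P (P′ ⊗ N) Q′))))
        (≋.trans (≋.assoc (P ⊗ (P′ ⊗ N)) Q′ Q) (≋.∙-congʳ (≋.sym (≋.assoc P P′ N)))))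
  }
  where
  P  = mat (left L∼M)
  P′ = mat (left M∼N)
  Q  = mat (right L∼M)
  Q′ = mat (right M∼N)

∼-ᵀ : {M N : Matrix ℤ n} → M ∼ N → M ᵀ ∼ N ᵀ
∼-ᵀ {M = M} {N} M∼N = record
  { left    = right M∼N ᵀSL
  ; right   = left M∼N ᵀSL
  ; factors = ≋.trans (entrywise λ i j → at (factors M∼N) j i)
      (≋.trans (ᵀ-⊗ (P ⊗ N) Q) (≋.trans (≋.∙-congˡ (ᵀ-⊗ P N)) (≋.sym (≋.assoc (Q ᵀ) (N ᵀ) (P ᵀ)))))
  }
  where
  P = mat (left M∼N)
  Q = mat (right M∼N)

∼-⊗ : (P : SL n) (M : Matrix ℤ n) → M ∼ mat P ⊗ M
∼-⊗ P M = record
  { left    = P ⁻¹SL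
  ; right   = SL-id
  ; factors = ≋.sym (≋.trans (≋.identityʳ (inv P ⊗ (mat P ⊗ M))) (≋.cancelˡ (inv⊗mat P) M))
  }

∼-⊕ : ∀ a {M N : Matrix ℤ n} → M ∼ N → a ⊕ M ∼ a ⊕ N
∼-⊕ a {M} {N} M∼N = record
  { left    = SL-lift (left M∼N)
  ; right   = SL-lift (right M∼N)
  ; factors = ≋.trans (⊕-cong (sym (trans (*-identityʳ (1ℤ * a)) (*-identityˡ a))) (factors M∼N))
      (≋.sym (≋.trans (≋.∙-congʳ (⊕-⊗-⊕ 1ℤ a (mat (left M∼N)) N))
                      (⊕-⊗-⊕ (1ℤ * a) 1ℤ (mat (left M∼N) ⊗ N) (mat (right M∼N)))))
  }

Splits : Matrix ℤ (suc n) → Set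
Splits M = ∃[ a ] ∃[ N ] (M ∼ a ⊕ N)

-- All reductions act on rows; transposition supplies the column operations.
splits-ᵀ : {M : Matrix ℤ (suc n)} → Splits (M ᵀ) → Splits M
splits-ᵀ (a , N , Mᵀ∼) = a , N ᵀ , ∼-trans (∼-ᵀ Mᵀ∼) (≋⇒∼ (⊕-ᵀ a N))

-- Reducing the first row of a matrix with first column (d , 0 , … , 0) either
-- leaves that column alone, or makes the pivot d smaller.
splits-loop : (M : Matrix ℤ (suc n)) (d : ℤ) → (λ i → M i zero) ≗ d ∷ 0s → Acc _≺_ d → Splits M
splits-loop {n} M d column (acc rs) with reduce (M zero)
... | d′ , P , reduced , outcome = splits-ᵀ {M = M} (splits (subst-outcome outcome))
  where
  M′ : Matrix ℤ (suc n)
  M′ = mat P ⊗ M ᵀ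
  column′ : (λ i → M′ i zero) ≗ d′ ∷ 0s
  column′ i = trans (⊗-column (mat P) (M ᵀ) i zero) (reduced i)
  subst-outcome : FixesRow₀ P ⊎ d′ ≺ M zero zero → FixesRow₀ P ⊎ d′ ≺ d
  subst-outcome = subst (λ z → FixesRow₀ P ⊎ d′ ≺ z) (column zero)
  splits : FixesRow₀ P ⊎ d′ ≺ d → Splits (M ᵀ)
  splits (inj₂ d′≺d) with splits-loop M′ d′ column′ (rs d′≺d)
  ... | a , N , M′∼ = a , N , ∼-trans (∼-⊗ P (M ᵀ)) M′∼
  -- Row zero of `M′` is still that of `M ᵀ`, the first column of `M`, which was clear beforehand.
  splits (inj₁ fixes) = d′ , (λ i j → M′ (suc i) (suc j)) , ∼-trans (∼-⊗ P (M ᵀ)) (≋⇒∼ (entrywise block))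
    where
    block : ∀ i j → M′ i j ≡ (d′ ⊕ λ i j → M′ (suc i) (suc j)) i j
    block zero    zero    = column′ zero
    block zero    (suc j) = trans (FixesRow₀-⊗ P fixes (M ᵀ) (suc j)) (column (suc j))
    block (suc i) zero    = column′ (suc i)
    block (suc i) (suc j) = refl

splits : (M : Matrix ℤ (suc n)) → Splits M
splits M with reduce (λ i → M i zero)
... | d , P , reduced , _ with splits-loop (mat P ⊗ M) d
      (λ i → trans (⊗-column (mat P) M i zero) (reduced i)) (≺-wellFounded d)
...   | a , N , M′∼ = a , N , ∼-trans (∼-⊗ P M) M′∼

-- A mere diagonal form: the entries need not divide one another as in the Smith normal form.
diagonalise : (M : Matrix ℤ n) → ∃[ d ] (M ∼ diag d)
diagonalise {zero}  M = (λ ()) , ≋⇒∼ (entrywise λ ())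
diagonalise {suc n} M with splits M
... | a , N , M∼ with diagonalise N
...   | d , N∼ = a ∷ d , ∼-trans M∼ (∼-⊕ a N∼)

det-mat : (P : SL n) → det (mat P) ≡ 1ℤ
det-mat {n} P = trans (det-cong (≋.sym (≋.identityʳ (mat P)))) (trans (det-mat⊗ P 𝟙) (det-𝟙 n))

private
  det-PDQ : ∀ {M} {d : Vector ℤ n} (M∼ : M ∼ diag d) → ∀ N → det (M ⊗ N) ≡ product d * det (mat (right M∼) ⊗ N)
  det-PDQ {d = d} M∼ N = begin
    det (_ ⊗ N)
      ≡⟨ det-cong (≋.trans (≋.∙-congʳ (factors M∼)) (≋.trans (≋.assoc (P ⊗ diag d) Q N) (≋.assoc P (diag d) (Q ⊗ N)))) ⟩
    det (P ⊗ (diag d ⊗ (Q ⊗ N)))  ≡⟨ det-mat⊗ (left M∼) (diag d ⊗ (Q ⊗ N)) ⟩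
    det (diag d ⊗ (Q ⊗ N))        ≡⟨ det-diag-⊗ d (Q ⊗ N) ⟩
    product d * det (Q ⊗ N)       ∎
    where
    open ≡-Reasoning
    P = mat (left M∼)
    Q = mat (right M∼)

det-∼diag : ∀ {M} {d : Vector ℤ n} → M ∼ diag d → det M ≡ product d
det-∼diag {n} {M} {d} M∼ = begin
  det M                                ≡⟨ det-cong (≋.identityʳ M) ⟨
  det (M ⊗ 𝟙)                          ≡⟨ det-PDQ M∼ 𝟙 ⟩
  product d * det (mat (right M∼) ⊗ 𝟙) ≡⟨ cong (product d *_) (trans (det-mat⊗ (right M∼) 𝟙) (det-𝟙 n)) ⟩
  product d * 1ℤ                       ≡⟨ *-identityʳ (product d) ⟩
  product d                            ∎
  where open ≡-Reasoning

-- Unimodular left factors satisfy this by construction and diagonal ones by scaling rows; the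
-- diagonal form of `M` combines the two.
det-⊗ : (M N : Matrix ℤ n) → det (M ⊗ N) ≡ det M * det N
det-⊗ M N with diagonalise M
... | d , M∼ = begin
  det (M ⊗ N)                          ≡⟨ det-PDQ M∼ N ⟩
  product d * det (mat (right M∼) ⊗ N) ≡⟨ cong₂ _*_ (sym (det-∼diag M∼)) (det-mat⊗ (right M∼) N) ⟩
  det M * det N                        ∎
  where open ≡-Reasoning

det-diag : (d : Vector ℤ n) → det (diag d) ≡ product d
det-diag d = det-∼diag (≋⇒∼ (≋.refl {x = diag d}))

-- Counting cokernels

-- The difference is at most the larger of `r` and `s` in absolute value, so the only multiple of
-- `d` it can be is zero.
remainder-unique : ∀ {d r s} → r < ∣ d ∣ → s < ∣ d ∣ → d ∣ + r - + s → r ≡ s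
remainder-unique {d} {r} {s} r<d s<d d∣ = +-injective (i-j≡0⇒i≡j (+ r) (+ s) (∣i∣≡0⇒i≡0 difference))
  where
  small : ∣ + r - + s ∣ < ∣ d ∣
  small = ℕ.≤-<-trans (ℕ.≤-reflexive (cong ∣_∣ (m-n≡m⊖n r s)))
            (ℕ.≤-<-trans (∣m⊝n∣≤m⊔n r s) (ℕ.⊔-pres-<m r<d s<d))
  difference : ∣ + r - + s ∣ ≡ 0
  difference with ∣ + r - + s ∣ | ∣⇒∣ᵤ d∣ | small
  ... | zero  | _     | _     = refl
  ... | suc k | d∣1+k | 1+k<d = contradiction (ℕ.∣⇒≤ d∣1+k) (ℕ.<⇒≱ 1+k<d)

%-cong : ∀ {d x y} (d≢0 : d ≢ 0ℤ) → d ∣ x - y →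
         (_%_ x d {{≢-nonZero d≢0}}) ≡ (_%_ y d {{≢-nonZero d≢0}})
%-cong {d} {x} {y} d≢0 (divides q x-y≡qd) =
  remainder-unique {d} (n%d<d x d) (n%d<d y d) (divides (q - x / d + y / d) eq)
  where
  instance
    _ = ≢-nonZero d≢0
  lemma₁ : ∀ r s p q d → r - s ≡ (r + p * d) - (s + q * d) - p * d + q * d
  lemma₁ = solve-∀
  lemma₂ : ∀ q p r d → q * d - p * d + r * d ≡ (q - p + r) * d
  lemma₂ = solve-∀
  eq : + (x % d) - + (y % d) ≡ (q - x / d + y / d) * d
  eq = begin
    + (x % d) - + (y % d)
      ≡⟨ lemma₁ (+ (x % d)) (+ (y % d)) (x / d) (y / d) d ⟩
    (+ (x % d) + x / d * d) - (+ (y % d) + y / d * d) - x / d * d + y / d * d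
      ≡⟨ cong₂ (λ a b → a - b - x / d * d + y / d * d) (a≡a%n+[a/n]*n x d) (a≡a%n+[a/n]*n y d) ⟨
    x - y - x / d * d + y / d * d
      ≡⟨ cong (λ a → a - x / d * d + y / d * d) x-y≡qd ⟩
    q * d - x / d * d + y / d * d
      ≡⟨ lemma₂ q (x / d) (y / d) d ⟩
    (q - x / d + y / d) * d ∎
    where open ≡-Reasoning

+%≡ : ∀ {d r} (d≢0 : d ≢ 0ℤ) → r < ∣ d ∣ → (_%_ (+ r) d {{≢-nonZero d≢0}}) ≡ r
+%≡ {d} {r} d≢0 r<d = sym (remainder-unique {d} r<d (n%d<d (+ r) d) (divides (+ r / d) eq))
  where
  instance
    _ = ≢-nonZero d≢0
  lemma : ∀ a b → a + b - a ≡ b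
  lemma = solve-∀
  eq : + r - + (+ r % d) ≡ + r / d * d
  eq = trans (cong (_- + (+ r % d)) (a≡a%n+[a/n]*n (+ r) d)) (lemma (+ (+ r % d)) (+ r / d * d))

∣%-x : ∀ {d} x (d≢0 : d ≢ 0ℤ) → d ∣ + (_%_ x d {{≢-nonZero d≢0}}) - x
∣%-x {d} x d≢0 = divides (- (x / d)) eq
  where
  instance
    _ = ≢-nonZero d≢0
  lemma : ∀ a q d → a - (a + q * d) ≡ - q * d
  lemma = solve-∀
  eq : + (x % d) - x ≡ - (x / d) * d
  eq = trans (cong (λ z → + (x % d) - z) (a≡a%n+[a/n]*n x d)) (lemma (+ (x % d)) (x / d) d)

AllNonZero : Vector ℤ n → Set
AllNonZero d = ∀ i → d i ≢ 0ℤ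

-- A product of naturals, so that `Fin (size d)` unfolds to the shape expected by `combine` and
-- `remQuot`.
size : Vector ℤ n → ℕ
size {zero}  d = 1
size {suc n} d = ∣ d zero ∣ ℕ.* size (d ∘ suc)

size≡∣product∣ : (d : Vector ℤ n) → size d ≡ ∣ product d ∣
size≡∣product∣ {zero}  d = refl
size≡∣product∣ {suc n} d = trans (cong (∣ d zero ∣ ℕ.*_) (size≡∣product∣ (d ∘ suc)))
                                 (sym (abs-* (d zero) (product (d ∘ suc))))

product≢0⇒AllNonZero : (d : Vector ℤ n) → product d ≢ 0ℤ → AllNonZero d
product≢0⇒AllNonZero {suc n} d p≢0 zero    d₀≡0 = p≢0 (cong (_* product (d ∘ suc)) d₀≡0)
product≢0⇒AllNonZero {suc n} d p≢0 (suc i)      = product≢0⇒AllNonZero (d ∘ suc)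
  (λ p≡0 → p≢0 (trans (cong (d zero *_) p≡0) (*-zeroʳ (d zero)))) i

digit : ∀ d → d ≢ 0ℤ → ℤ → Fin ∣ d ∣
digit d d≢0 x = fromℕ< (n%d<d x d {{≢-nonZero d≢0}})

digit-cong : ∀ d (d≢0 : d ≢ 0ℤ) x y → d ∣ x - y → digit d d≢0 x ≡ digit d d≢0 y
digit-cong d d≢0 x y d∣ = Fin.fromℕ<-cong _ _ (%-cong {d} {x} {y} d≢0 d∣) _ _

digit-toℕ : ∀ d (d≢0 : d ≢ 0ℤ) (k : Fin ∣ d ∣) → digit d d≢0 (+ toℕ k) ≡ k
digit-toℕ d d≢0 k = trans (Fin.fromℕ<-cong _ _ (+%≡ {d} d≢0 (Fin.toℕ<n k)) _ (Fin.toℕ<n k)) (Fin.fromℕ<-toℕ k (Fin.toℕ<n k))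

toℕ-digit : ∀ d (d≢0 : d ≢ 0ℤ) x → d ∣ + toℕ (digit d d≢0 x) - x
toℕ-digit d d≢0 x = subst (λ z → d ∣ + z - x) (sym (Fin.toℕ-fromℕ< _)) (∣%-x x d≢0)

-- Mixed-radix representatives of ℤⁿ modulo d₁ℤ × … × dₙℤ.
encode : (d : Vector ℤ n) → AllNonZero d → Vector ℤ n → Fin (size d)
encode {zero}  d d≢0 x = zero
encode {suc n} d d≢0 x =
  combine (digit (d zero) (d≢0 zero) (x zero)) (encode (d ∘ suc) (d≢0 ∘ suc) (x ∘ suc))

decode : (d : Vector ℤ n) → Fin (size d) → Vector ℤ n
decode {suc n} d k zero    = + toℕ (proj₁ (remQuot {∣ d zero ∣} (size (d ∘ suc)) k))
decode {suc n} d k (suc i) = decode (d ∘ suc) (proj₂ (remQuot {∣ d zero ∣} (size (d ∘ suc)) k)) i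

encode-cong : (d : Vector ℤ n) (d≢0 : AllNonZero d) (x y : Vector ℤ n) →
              (∀ i → d i ∣ x i - y i) → encode d d≢0 x ≡ encode d d≢0 y
encode-cong {zero}  d d≢0 x y x≡y = refl
encode-cong {suc n} d d≢0 x y x≡y = cong₂ combine
  (digit-cong (d zero) (d≢0 zero) (x zero) (y zero) (x≡y zero))
  (encode-cong (d ∘ suc) (d≢0 ∘ suc) (x ∘ suc) (y ∘ suc) (x≡y ∘ suc))

encode-decode : (d : Vector ℤ n) (d≢0 : AllNonZero d) (k : Fin (size d)) → encode d d≢0 (decode d k) ≡ k
encode-decode {zero}  d d≢0 zero = refl
encode-decode {suc n} d d≢0 k    = trans
  (cong₂ combine
    (digit-toℕ (d zero) (d≢0 zero) (proj₁ (remQuot {∣ d zero ∣} (size (d ∘ suc)) k)))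
    (encode-decode (d ∘ suc) (d≢0 ∘ suc) (proj₂ (remQuot {∣ d zero ∣} (size (d ∘ suc)) k))))
  (Fin.combine-remQuot {∣ d zero ∣} (size (d ∘ suc)) k)

decode-encode : (d : Vector ℤ n) (d≢0 : AllNonZero d) (x : Vector ℤ n) →
                ∀ i → d i ∣ decode d (encode d d≢0 x) i - x i
decode-encode {suc n} d d≢0 x i = entry i
  where
  r : Fin ∣ d zero ∣
  r = digit (d zero) (d≢0 zero) (x zero)
  k : Fin (size (d ∘ suc))
  k = encode (d ∘ suc) (d≢0 ∘ suc) (x ∘ suc)
  entry : ∀ i → d i ∣ decode d (combine r k) i - x i
  entry zero    = subst (λ z → d zero ∣ + toℕ (proj₁ z) - x zero) (sym (Fin.remQuot-combine r k))
                        (toℕ-digit (d zero) (d≢0 zero) (x zero))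
  entry (suc i) = subst (λ z → d (suc i) ∣ decode (d ∘ suc) (proj₂ z) i - x (suc i)) (sym (Fin.remQuot-combine r k))
                        (decode-encode (d ∘ suc) (d≢0 ∘ suc) (x ∘ suc) i)

infixl 6 _−_

_−_ : Vector ℤ n → Vector ℤ n → Vector ℤ n
(x − y) i = x i - y i

apply-− : (A : Matrix ℤ n) (x y : Vector ℤ n) → apply A (x − y) ≗ apply A x − apply A y
apply-− A x y i = trans (homo x (λ j → - y j) i) (cong (_+_ (apply A x i)) (⁻¹-homo y i))
  where open GroupHomomorphism (ℤMod.matrixHom A) using (homo; ⁻¹-homo)

apply-cancel : {A B : Matrix ℤ n} → A ⊗ B ≋ 𝟙 → ∀ x → apply A (apply B x) ≗ x
apply-cancel {A = A} {B} AB≋𝟙 x i =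
  trans (sym (apply-⊗ A B x i)) (trans (apply-congˡ AB≋𝟙 x i) (apply-𝟙 x i))

apply-diag : (d x : Vector ℤ n) → apply (diag d) x ≗ λ i → d i * x i
apply-diag = sum-diagˡ

InImage : Matrix ℤ n → Vector ℤ n → Set
InImage M v = ∃[ x ] (apply M x ≗ v)

module Diagonalised {M : Matrix ℤ n} {d : Vector ℤ n} (M∼ : M ∼ diag d) where
  P P⁻¹ Q Q⁻¹ : Vector ℤ n → Vector ℤ n
  P   = apply (mat (left M∼))
  P⁻¹ = apply (inv (left M∼))
  Q   = apply (mat (right M∼))
  Q⁻¹ = apply (inv (right M∼))

  P-P⁻¹ : ∀ x → P (P⁻¹ x) ≗ x
  P-P⁻¹ = apply-cancel (mat⊗inv (left M∼))

  P⁻¹-P : ∀ x → P⁻¹ (P x) ≗ x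
  P⁻¹-P = apply-cancel (inv⊗mat (left M∼))

  Q-Q⁻¹ : ∀ x → Q (Q⁻¹ x) ≗ x
  Q-Q⁻¹ = apply-cancel (mat⊗inv (right M∼))

  P-cong : ∀ {x y} → x ≗ y → P x ≗ P y
  P-cong = apply-cong (mat (left M∼))

  P⁻¹-cong : ∀ {x y} → x ≗ y → P⁻¹ x ≗ P⁻¹ y
  P⁻¹-cong = apply-cong (inv (left M∼))

  apply-PDQ : ∀ x → apply M x ≗ P (λ i → d i * Q x i)
  apply-PDQ x i = begin
    apply M x i
      ≡⟨ apply-congˡ (factors M∼) x i ⟩
    apply (mat (left M∼) ⊗ diag d ⊗ mat (right M∼)) x i
      ≡⟨ apply-⊗ (mat (left M∼) ⊗ diag d) (mat (right M∼)) x i ⟩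
    apply (mat (left M∼) ⊗ diag d) (Q x) i
      ≡⟨ apply-⊗ (mat (left M∼)) (diag d) (Q x) i ⟩
    P (apply (diag d) (Q x)) i
      ≡⟨ P-cong (apply-diag d (Q x)) i ⟩
    P (λ i → d i * Q x i) i ∎
    where open ≡-Reasoning

  P⁻¹-apply : ∀ x → P⁻¹ (apply M x) ≗ λ i → d i * Q x i
  P⁻¹-apply x i = trans (P⁻¹-cong (apply-PDQ x) i) (P⁻¹-P (λ i → d i * Q x i) i)

  apply-Q⁻¹ : ∀ y → apply M (Q⁻¹ y) ≗ P (λ i → d i * y i)
  apply-Q⁻¹ y i = trans (apply-PDQ (Q⁻¹ y) i) (P-cong (λ j → cong (d j *_) (Q-Q⁻¹ y j)) i)

  -- In the coordinates given by `P` the image of `M` is d₁ℤ × ... × dₙℤ, because `Q` is onto.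
  image⇒∣ : ∀ {v} → InImage M v → ∀ i → d i ∣ P⁻¹ v i
  image⇒∣ {v} (x , Mx≗v) i =
    divides (Q x i) (trans (sym (P⁻¹-cong Mx≗v i)) (trans (P⁻¹-apply x i) (*-comm (d i) (Q x i))))

  ∣⇒image : ∀ {v} → (∀ i → d i ∣ P⁻¹ v i) → InImage M v
  ∣⇒image {v} d∣ = Q⁻¹ y , λ i → trans (apply-Q⁻¹ y i) (trans (P-cong eq i) (P-P⁻¹ v i))
    where
    y : Vector ℤ n
    y i = _∣_.quotient (d∣ i)
    eq : (λ i → d i * y i) ≗ P⁻¹ v
    eq i = trans (*-comm (d i) (y i)) (sym (_∣_.equality (d∣ i)))

module _ (G : AbGroup) (N : Matrix ℤ n) (det≢0 : det N ≢ 0ℤ) where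
  open AbelianGroup G using (Carrier; _≈_) renaming (sym to ≈-sym; trans to ≈-trans; reflexive to ≈-reflexive)

  module _ (f : Vector ℤ n → Carrier) (s : Carrier → Vector ℤ n) (f-s : ∀ g → f (s g) ≈ g)
           (image⇒≈ : ∀ x y → InImage N (x − y) → f x ≈ f y)
           (≈⇒image : ∀ x y → f x ≈ f y → InImage N (x − y)) where

    -- `f` presents `G` as ℤⁿ / N ℤⁿ, and `s` picks representatives. In the diagonal form of `N` a
    -- class is determined by its mixed-radix digits. Both the torsion group and `𝓡` are counted
    -- this way.
    coker-cardinality : HasCardinality G ∣ det N ∣
    coker-cardinality with diagonalise N
    ... | d , N∼ = subst (HasCardinality G)
                         (trans (size≡∣product∣ d) (cong ∣_∣ (sym (det-∼diag N∼)))) record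
      { to        = to
      ; from      = from
      ; to-cong   = λ k≡l → ≈-reflexive (cong to k≡l)
      ; from-cong = from-cong
      ; inverse   = (λ {g} k≡from → ≈-trans (≈-reflexive (cong to k≡from)) (to-from g))
                  , (λ {k} {g} g≈to → trans (from-cong g≈to) (from-to k))
      }
      where
      open Diagonalised N∼
      d≢0 : AllNonZero d
      d≢0 = product≢0⇒AllNonZero d (λ p≡0 → det≢0 (trans (det-∼diag N∼) p≡0))
      to : Fin (size d) → Carrier
      to k = f (P (decode d k))
      from : Carrier → Fin (size d)
      from g = encode d d≢0 (P⁻¹ (s g))
      ≈⇒∣ : ∀ x y → f x ≈ f y → ∀ i → d i ∣ P⁻¹ x i - P⁻¹ y i
      ≈⇒∣ x y fx≈fy i = subst (d i ∣_) (apply-− (inv (left N∼)) x y i) (image⇒∣ (≈⇒image x y fx≈fy) i)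
      from-cong : ∀ {g h} → g ≈ h → from g ≡ from h
      from-cong {g} {h} g≈h = encode-cong d d≢0 (P⁻¹ (s g)) (P⁻¹ (s h))
        (≈⇒∣ (s g) (s h) (≈-trans (f-s g) (≈-trans g≈h (≈-sym (f-s h)))))
      to-from : ∀ g → to (from g) ≈ g
      to-from g = ≈-trans (image⇒≈ (P y) (s g) (∣⇒image λ i → subst (d i ∣_) (sym (eq i)) (decode-encode d d≢0 (P⁻¹ (s g)) i)))
                          (f-s g)
        where
        y : Vector ℤ n
        y = decode d (from g)
        eq : P⁻¹ (P y − s g) ≗ y − P⁻¹ (s g)
        eq i = trans (apply-− (inv (left N∼)) (P y) (s g) i) (cong (_- P⁻¹ (s g) i) (P⁻¹-P y i))
      from-to : ∀ k → from (to k) ≡ k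
      from-to k = trans
        (encode-cong d d≢0 (P⁻¹ (s (to k))) (decode d k) λ i →
          subst (λ z → d i ∣ P⁻¹ (s (to k)) i - z) (P⁻¹-P (decode d k) i)
                (≈⇒∣ (s (to k)) (P (decode d k)) (f-s (to k)) i))
        (encode-decode d d≢0 k)

-- Polynomials as functions on ℤ

eval : ℤ[u] → ℤ → ℤ
eval []      x = 0ℤ
eval (c ∷ₚ p) x = c + x * eval p x

eval-+ₚ : ∀ p q x → eval (p +ₚ q) x ≡ eval p x + eval q x
eval-+ₚ []      q       x = sym (+-identityˡ (eval q x))
eval-+ₚ (a ∷ₚ p) []      x = sym (+-identityʳ (a + x * eval p x))
eval-+ₚ (a ∷ₚ p) (b ∷ₚ q) x = trans (cong (λ z → a + b + x * z) (eval-+ₚ p q x)) (lemma a b x (eval p x) (eval q x))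
  where
  lemma : ∀ a b x p q → a + b + x * (p + q) ≡ a + x * p + (b + x * q)
  lemma = solve-∀

eval-scale : ∀ a p x → eval (map (a *_) p) x ≡ a * eval p x
eval-scale a []      x = sym (*-zeroʳ a)
eval-scale a (b ∷ₚ p) x = trans (cong (λ z → a * b + x * z) (eval-scale a p x)) (lemma a b x (eval p x))
  where
  lemma : ∀ a b x p → a * b + x * (a * p) ≡ a * (b + x * p)
  lemma = solve-∀

eval--ₚ : ∀ p x → eval (-ₚ p) x ≡ - eval p x
eval--ₚ []      x = refl
eval--ₚ (b ∷ₚ p) x = trans (cong (λ z → - b + x * z) (eval--ₚ p x)) (lemma b x (eval p x))
  where
  lemma : ∀ b x p → - b + x * (- p) ≡ - (b + x * p)
  lemma = solve-∀

eval-*ₚ : ∀ p q x → eval (p *ₚ q) x ≡ eval p x * eval q x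
eval-*ₚ []      q x = sym (*-zeroˡ (eval q x))
eval-*ₚ (a ∷ₚ p) q x = begin
  eval (map (a *_) q +ₚ (0ℤ ∷ₚ p *ₚ q)) x
    ≡⟨ eval-+ₚ (map (a *_) q) (0ℤ ∷ₚ p *ₚ q) x ⟩
  eval (map (a *_) q) x + (0ℤ + x * eval (p *ₚ q) x)
    ≡⟨ cong₂ (λ y z → y + (0ℤ + x * z)) (eval-scale a q x) (eval-*ₚ p q x) ⟩
  a * eval q x + (0ℤ + x * (eval p x * eval q x))
    ≡⟨ lemma a x (eval p x) (eval q x) ⟩
  (a + x * eval p x) * eval q x ∎
  where
  open ≡-Reasoning
  lemma : ∀ a x p q → a * q + (0ℤ + x * (p * q)) ≡ (a + x * p) * q
  lemma = solve-∀

eval-const : ∀ c x → eval (const c) x ≡ c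
eval-const c x = trans (cong (_+_ c) (*-zeroʳ x)) (+-identityʳ c)

eval-taylor₁ : ∀ p t → eval (taylor₁ p) t ≡ eval p (1ℤ + t)
eval-taylor₁ []      t = refl
eval-taylor₁ (c ∷ₚ p) t = begin
  eval (const c +ₚ (1ℤ ∷ₚ 1ℤ ∷ₚ []) *ₚ taylor₁ p) t
    ≡⟨ eval-+ₚ (const c) ((1ℤ ∷ₚ 1ℤ ∷ₚ []) *ₚ taylor₁ p) t ⟩
  eval (const c) t + eval ((1ℤ ∷ₚ 1ℤ ∷ₚ []) *ₚ taylor₁ p) t
    ≡⟨ cong₂ _+_ (eval-const c t) (eval-*ₚ (1ℤ ∷ₚ 1ℤ ∷ₚ []) (taylor₁ p) t) ⟩
  c + (1ℤ + t * (1ℤ + t * 0ℤ)) * eval (taylor₁ p) t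
    ≡⟨ cong₂ (λ y z → c + y * z) (lemma t) (eval-taylor₁ p t) ⟩
  c + (1ℤ + t) * eval p (1ℤ + t) ∎
  where
  open ≡-Reasoning
  lemma : ∀ t → 1ℤ + t * (1ℤ + t * 0ℤ) ≡ 1ℤ + t
  lemma = solve-∀

module ℤ[u]-det = Determinant ℤ[u]-rawRing

eval-det : (M : Matrix ℤ[u] n) → ∀ x → eval (ℤ[u]-det.det M) x ≡ det (λ i j → eval (M i j) x)
eval-det {zero}  M x = eval-const 1ℤ x
eval-det {suc n} M x = trans (eval-sum term) (sum-cong-≗ eval-term)
  where
  open RawMonoidDefs (RawRing.+-rawMonoid ℤ[u]-rawRing) using () renaming (sum to sumₚ)
  open RawSemiringDefs (RawRing.rawSemiring ℤ[u]-rawRing) using () renaming (_^_ to _^ₚ_)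
  eval-sum : ∀ {n} (f : Vector ℤ[u] n) → eval (sumₚ f) x ≡ sum (λ j → eval (f j) x)
  eval-sum {zero}  f = refl
  eval-sum {suc n} f = trans (eval-+ₚ (f zero) (sumₚ (f ∘ suc)) x) (cong (_+_ (eval (f zero) x)) (eval-sum (f ∘ suc)))
  eval-sign : ∀ k → eval ((-ₚ const 1ℤ) ^ₚ k) x ≡ -1ℤ ^ k
  eval-sign zero    = eval-const 1ℤ x
  eval-sign (suc k) = trans (eval-*ₚ (-ₚ const 1ℤ) ((-ₚ const 1ℤ) ^ₚ k) x)
                            (cong₂ _*_ (eval-const -1ℤ x) (eval-sign k))
  term : Vector ℤ[u] (suc n)
  term j = (-ₚ const 1ℤ) ^ₚ toℕ j *ₚ (M zero j *ₚ ℤ[u]-det.det (ℤ[u]-det.minor M j))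
  eval-term : ∀ j → eval (term j) x ≡
              -1ℤ ^ toℕ j * (eval (M zero j) x * det (minor (λ i j → eval (M i j) x) j))
  eval-term j = trans
    (eval-*ₚ ((-ₚ const 1ℤ) ^ₚ toℕ j) (M zero j *ₚ ℤ[u]-det.det (ℤ[u]-det.minor M j)) x)
    (cong₂ _*_ (eval-sign (toℕ j))
      (trans (eval-*ₚ (M zero j) (ℤ[u]-det.det (ℤ[u]-det.minor M j)) x)
             (cong (_*_ (eval (M zero j) x)) (eval-det (ℤ[u]-det.minor M j) x))))

-- The modulus `suc ∣ v ∣` decides. This replaces evaluation at `t = 0`: a constant term is
-- recovered from congruences modulo nonzero `t`.
∣-all⇒≡0 : ∀ v → (∀ t → t ≢ 0ℤ → t ∣ v) → v ≡ 0ℤ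
∣-all⇒≡0 v t∣v = ∣i∣≡0⇒i≡0 (small ∣ v ∣ (∣⇒∣ᵤ (t∣v (+ suc ∣ v ∣) λ ())))
  where
  small : ∀ k → suc k ℕ.∣ k → k ≡ 0
  small zero    _     = refl
  small (suc k) 2+k∣1+k = contradiction (ℕ.∣⇒≤ 2+k∣1+k) (ℕ.<⇒≱ (ℕ.n<1+n (suc k)))

tail : ℤ[u] → ℤ[u]
tail []      = []
tail (c ∷ₚ p) = p

eval-tail : ∀ p t → eval p t ≡ coeff p 0 + t * eval (tail p) t
eval-tail []      t = sym (trans (+-identityˡ (t * 0ℤ)) (*-zeroʳ t))
eval-tail (c ∷ₚ p) t = refl

coeff-tail : ∀ p k → coeff p (suc k) ≡ coeff (tail p) k
coeff-tail []      k = refl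
coeff-tail (c ∷ₚ p) k = refl

-- Only values at t ≠ 0 are used, so that a factor t can be cancelled.
leading-coeff : ∀ z p c (q : ℤ → ℤ) → (∀ t → t ≢ 0ℤ → eval p t ≡ t ^ z * q t) → (∀ t → t ∣ q t - c) →
                (∀ k → k < z → coeff p k ≡ 0ℤ) × coeff p z ≡ c
leading-coeff zero p c q eval≡ t∣q-c = (λ _ ()) , i-j≡0⇒i≡j (coeff p 0) c (∣-all⇒≡0 (coeff p 0 - c) λ t t≢0 → divide t t≢0 (t∣q-c t))
  where
  divide : ∀ t → t ≢ 0ℤ → t ∣ q t - c → t ∣ coeff p 0 - c
  divide t t≢0 (divides k q-c≡kt) = divides (k - eval (tail p) t) (begin
    coeff p 0 - c
      ≡⟨ lemma₁ (coeff p 0) t (eval (tail p) t) c ⟩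
    (coeff p 0 + t * eval (tail p) t) - c - t * eval (tail p) t
      ≡⟨ cong (λ z → z - c - t * eval (tail p) t) (trans (sym (eval-tail p t)) (trans (eval≡ t t≢0) (*-identityˡ (q t)))) ⟩
    q t - c - t * eval (tail p) t
      ≡⟨ cong (_- t * eval (tail p) t) q-c≡kt ⟩
    k * t - t * eval (tail p) t
      ≡⟨ lemma₂ k t (eval (tail p) t) ⟩
    (k - eval (tail p) t) * t ∎)
    where
    open ≡-Reasoning
    lemma₁ : ∀ a t e c → a - c ≡ (a + t * e) - c - t * e
    lemma₁ = solve-∀
    lemma₂ : ∀ k t e → k * t - t * e ≡ (k - e) * t
    lemma₂ = solve-∀
leading-coeff (suc z) p c q eval≡ t∣q-c = low , trans (coeff-tail p z) (proj₂ rec)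
  where
  -- Both `eval p t` and `t * eval (tail p) t` are multiples of `t`, hence so is their difference.
  c₀≡0 : coeff p 0 ≡ 0ℤ
  c₀≡0 = ∣-all⇒≡0 (coeff p 0) λ t t≢0 → divides (t ^ z * q t - eval (tail p) t) (begin
    coeff p 0
      ≡⟨ lemma₁ (coeff p 0) t (eval (tail p) t) ⟩
    (coeff p 0 + t * eval (tail p) t) - t * eval (tail p) t
      ≡⟨ cong (_- t * eval (tail p) t) (trans (sym (eval-tail p t)) (eval≡ t t≢0)) ⟩
    t * t ^ z * q t - t * eval (tail p) t
      ≡⟨ lemma₂ t (t ^ z) (q t) (eval (tail p) t) ⟩
    (t ^ z * q t - eval (tail p) t) * t ∎)
    where
    open ≡-Reasoning
    lemma₁ : ∀ a t e → a ≡ (a + t * e) - t * e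
    lemma₁ = solve-∀
    lemma₂ : ∀ t s q e → t * s * q - t * e ≡ (s * q - e) * t
    lemma₂ = solve-∀
  cancel : ∀ t → t ≢ 0ℤ → eval (tail p) t ≡ t ^ z * q t
  cancel t t≢0 = *-cancelˡ-≡ t (eval (tail p) t) (t ^ z * q t) {{≢-nonZero t≢0}} (begin
    t * eval (tail p) t              ≡⟨ +-identityˡ (t * eval (tail p) t) ⟨
    0ℤ + t * eval (tail p) t         ≡⟨ cong (_+ t * eval (tail p) t) c₀≡0 ⟨
    coeff p 0 + t * eval (tail p) t  ≡⟨ eval-tail p t ⟨
    eval p t                         ≡⟨ eval≡ t t≢0 ⟩
    t * t ^ z * q t                  ≡⟨ *-assoc t (t ^ z) (q t) ⟩
    t * (t ^ z * q t)                ∎)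
    where open ≡-Reasoning
  rec = leading-coeff z (tail p) c q cancel t∣q-c
  low : ∀ k → k < suc z → coeff p k ≡ 0ℤ
  low zero    _         = c₀≡0
  low (suc k) (ℕ.s<s k<z) = trans (coeff-tail p k) (proj₁ rec k k<z)

-- On a zero polynomial `order₀` runs past the end of the list; the second alternative covers this.
coeff-order₀ : ∀ p → coeff p (order₀ p) ≢ 0ℤ ⊎ (∀ x → eval p x ≡ 0ℤ)
coeff-order₀ []      = inj₂ λ x → refl
coeff-order₀ (c ∷ₚ p) with c ≟ 0ℤ
... | no  c≢0  = inj₁ c≢0
... | yes refl with coeff-order₀ p
...   | inj₁ c≢0 = inj₁ c≢0
...   | inj₂ p≡0 = inj₂ λ x → trans (+-identityˡ (x * eval p x)) (trans (cong (x *_) (p≡0 x)) (*-zeroʳ x))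

-- The factor `t ^ z` kills all coefficients below `z`, so the order is at least `z`. With the
-- opposite bound it equals `z`, and `c` is nonzero because it is the coefficient found there.
order₀-unique : ∀ p {x₀} → eval p x₀ ≢ 0ℤ → ∀ z c (q : ℤ → ℤ) →
                (∀ t → t ≢ 0ℤ → eval p t ≡ t ^ z * q t) → (∀ t → t ∣ q t - c) →
                order₀ p ≤ z → c ≢ 0ℤ × coeff p (order₀ p) ≡ c
order₀-unique p {x₀} p≢0 z c q eval≡ t∣q-c order≤z with coeff-order₀ p | leading-coeff z p c q eval≡ t∣q-c
... | inj₂ p≡0 | _        = contradiction (p≡0 x₀) p≢0
... | inj₁ a≢0 | low , lead with ℕ.m≤n⇒m<n∨m≡n order≤z
...   | inj₁ order<z = contradiction (low (order₀ p) order<z) a≢0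
...   | inj₂ refl    = (λ c≡0 → a≢0 (trans lead c≡0)) , lead

-- Zero diagonal entries

zeros : Vector ℤ n → ℕ
zeros {zero}  d = 0
zeros {suc n} d with d zero ≟ 0ℤ
... | yes _ = suc (zeros (d ∘ suc))
... | no  _ = zeros (d ∘ suc)

isNonZero : ℤ → ℤ
isNonZero x with x ≟ 0ℤ
... | yes _ = 0ℤ
... | no  _ = 1ℤ

orOne : ℤ → ℤ
orOne x with x ≟ 0ℤ
... | yes _ = 1ℤ
... | no  _ = x

-- A nontrivial solution of the homogeneous system formed by the rows where `d` vanishes.
Dependent : (Fin n → Fin m → ℤ) → Vector ℤ n → Set
Dependent {m = m} A d =
  Σ[ c ∈ Vector ℤ m ] ((∃[ j ] (c j ≢ 0ℤ)) × (∀ i → d i ≡ 0ℤ → sum (λ j → A i j * c j) ≡ 0ℤ))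

-- A system with fewer equations than unknowns, solved by Gaussian elimination without fractions.
dependent : (A : Fin n → Fin m → ℤ) (d : Vector ℤ n) → zeros d < m → Dependent A d

-- The pivot column j₀ of the first row is used to clear that row.
eliminate : (A : Fin (suc n) → Fin (suc m) → ℤ) (d : Vector ℤ (suc n)) → zeros (d ∘ suc) < m →
            ∀ j₀ → A zero j₀ ≢ 0ℤ → Dependent A d
eliminate {n} {m} A d z<m j₀ a≢0 = c , (punchIn j₀ (proj₁ (proj₁ (proj₂ rec))) , c≢0) , relation
  where
  a : ℤ
  a = A zero j₀
  A′ : Fin n → Fin m → ℤ
  A′ i k = a * A (suc i) (punchIn j₀ k) - A zero (punchIn j₀ k) * A (suc i) j₀
  rec : Dependent A′ (d ∘ suc)
  rec = dependent A′ (d ∘ suc) z<m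
  c′ : Vector ℤ m
  c′ = proj₁ rec
  S : ℤ
  S = sum (λ k → A zero (punchIn j₀ k) * c′ k)
  -- Scaling the smaller solution by the pivot `a` lets the entry at `j₀` be the integer `- S`: row
  -- zero then gives `a * - S + a * S`.
  c : Vector ℤ (suc m)
  c = insertAt (λ k → a * c′ k) j₀ (- S)
  c≢0 : c (punchIn j₀ (proj₁ (proj₁ (proj₂ rec)))) ≢ 0ℤ
  c≢0 eq with i*j≡0⇒i≡0∨j≡0 a (trans (sym (insertAt-punchIn (λ k → a * c′ k) j₀ (- S) (proj₁ (proj₁ (proj₂ rec))))) eq)
  ... | inj₁ a≡0 = a≢0 a≡0
  ... | inj₂ c′≡0 = proj₂ (proj₁ (proj₂ rec)) c′≡0
  expand : ∀ i → sum (λ j → A i j * c j) ≡ A i j₀ * (- S) + sum (λ k → A i (punchIn j₀ k) * (a * c′ k))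
  expand i = trans (sum-remove {i = j₀} (λ j → A i j * c j))
    (cong₂ _+_ (cong (A i j₀ *_) (insertAt-lookup (λ k → a * c′ k) j₀ (- S)))
               (sum-cong-≗ (λ k → cong (_*_ (A i (punchIn j₀ k))) (insertAt-punchIn (λ k → a * c′ k) j₀ (- S) k))))
  relation : ∀ i → d i ≡ 0ℤ → sum (λ j → A i j * c j) ≡ 0ℤ
  relation zero d₀≡0 = begin
    sum (λ j → A zero j * c j)
      ≡⟨ expand zero ⟩
    a * (- S) + sum (λ k → A zero (punchIn j₀ k) * (a * c′ k))
      ≡⟨ cong (_+_ (a * - S)) (trans (sum-cong-≗ (λ k → lemma₁ (A zero (punchIn j₀ k)) a (c′ k)))
                                     (sym (*-distribˡ-sum a (λ k → A zero (punchIn j₀ k) * c′ k)))) ⟩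
    a * (- S) + a * S
      ≡⟨ lemma₂ a S ⟩
    0ℤ ∎
    where
    open ≡-Reasoning
    lemma₁ : ∀ x a c → x * (a * c) ≡ a * (x * c)
    lemma₁ = solve-∀
    lemma₂ : ∀ a s → a * - s + a * s ≡ 0ℤ
    lemma₂ = solve-∀
  relation (suc i) d≡0 = begin
    sum (λ j → A (suc i) j * c j)
      ≡⟨ expand (suc i) ⟩
    b * (- S) + sum (λ k → A (suc i) (punchIn j₀ k) * (a * c′ k))
      ≡⟨ cong (_+ sum (λ k → A (suc i) (punchIn j₀ k) * (a * c′ k)))
              (trans (lemma₁ b S) (*-distribˡ-sum (- b) (λ k → A zero (punchIn j₀ k) * c′ k))) ⟩
    sum (λ k → - b * (A zero (punchIn j₀ k) * c′ k)) + sum (λ k → A (suc i) (punchIn j₀ k) * (a * c′ k))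
      ≡⟨ ∑-distrib-+ (λ k → - b * (A zero (punchIn j₀ k) * c′ k)) (λ k → A (suc i) (punchIn j₀ k) * (a * c′ k)) ⟨
    sum (λ k → - b * (A zero (punchIn j₀ k) * c′ k) + A (suc i) (punchIn j₀ k) * (a * c′ k))
      ≡⟨ sum-cong-≗ (λ k → lemma₂ b (A zero (punchIn j₀ k)) (c′ k) (A (suc i) (punchIn j₀ k)) a) ⟩
    sum (λ k → A′ i k * c′ k)
      ≡⟨ proj₂ (proj₂ rec) i d≡0 ⟩
    0ℤ ∎
    where
    open ≡-Reasoning
    b : ℤ
    b = A (suc i) j₀
    lemma₁ : ∀ b s → b * - s ≡ - b * s
    lemma₁ = solve-∀
    lemma₂ : ∀ b x c y a → - b * (x * c) + y * (a * c) ≡ (a * y - x * b) * c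
    lemma₂ = solve-∀

dependent {zero}  {suc m} A d z<m = (λ _ → 1ℤ) , (zero , λ ()) , λ ()
dependent {suc n} {m}     A d z<m with d zero ≟ 0ℤ
... | no d₀≢0 = c , c≢0 , λ where
        zero    d₀≡0 → contradiction d₀≡0 d₀≢0
        (suc i) d≡0  → relation i d≡0
  where
  rec = dependent (A ∘ suc) (d ∘ suc) z<m
  c = proj₁ rec
  c≢0 = proj₁ (proj₂ rec)
  relation = proj₂ (proj₂ rec)
dependent {suc n} {suc m} A d (ℕ.s<s z<m) | yes _ with Fin.any? (λ j → ¬? (A zero j ≟ 0ℤ))
... | yes (j₀ , a≢0) = eliminate A d z<m j₀ a≢0
... | no  none       = c , c≢0 , λ where
        zero    _   → sum-zero {f = λ j → A zero j * c j} (λ j → trans (cong (_* c j) (row₀ j)) (*-zeroˡ (c j)))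
        (suc i) d≡0 → relation i d≡0
  where
  row₀ : ∀ j → A zero j ≡ 0ℤ
  row₀ j = decidable-stable (A zero j ≟ 0ℤ) (λ a≢0 → none (j , a≢0))
  rec = dependent (A ∘ suc) (d ∘ suc) (ℕ.m<n⇒m<1+n z<m)
  c = proj₁ rec
  c≢0 = proj₁ (proj₂ rec)
  relation = proj₂ (proj₂ rec)

entry∣product : (d : Vector ℤ n) → ∀ i → d i ∣ product d
entry∣product {suc n} d zero    = ∣m⇒∣m*n (product (d ∘ suc)) ∣-refl
entry∣product {suc n} d (suc i) = ∣n⇒∣m*n (d zero) (entry∣product (d ∘ suc) i)

product-orOne≢0 : (d : Vector ℤ n) → product (orOne ∘ d) ≢ 0ℤ
product-orOne≢0 {zero}  d ()
product-orOne≢0 {suc n} d eq with i*j≡0⇒i≡0∨j≡0 (orOne (d zero)) eq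
... | inj₂ p≡0 = product-orOne≢0 (d ∘ suc) p≡0
... | inj₁ d₀≡0 with d zero ≟ 0ℤ
...   | yes _    = contradiction d₀≡0 λ ()
...   | no  d₀≢0 = d₀≢0 d₀≡0

zeroFactor : ℤ → ℤ → ℤ
zeroFactor t x with x ≟ 0ℤ
... | yes _ = - t
... | no  _ = 1ℤ

product-zeroFactor : ∀ t (d : Vector ℤ n) → product (zeroFactor t ∘ d) ≡ t ^ zeros d * -1ℤ ^ zeros d
product-zeroFactor {zero}  t d = refl
product-zeroFactor {suc n} t d with d zero ≟ 0ℤ
... | yes _ = trans (cong (- t *_) (product-zeroFactor t (d ∘ suc)))
                    (lemma t (t ^ zeros (d ∘ suc)) (-1ℤ ^ zeros (d ∘ suc)))
  where
  lemma : ∀ t x y → - t * (x * y) ≡ t * x * (-1ℤ * y)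
  lemma = solve-∀
... | no  _ = trans (*-identityˡ (product (zeroFactor t ∘ d ∘ suc))) (product-zeroFactor t (d ∘ suc))

-- The determinant is an integer polynomial in the entries, so it respects congruences; products are
-- handled one factor at a time.
det-mod : ∀ t (A B : Matrix ℤ n) → (∀ i j → t ∣ A i j - B i j) → t ∣ det A - det B
det-mod {zero}  t A B t∣ = divides 0ℤ refl
det-mod {suc n} t A B t∣ = subst (t ∣_) eq (∣-sum terms)
  where
  s : Fin (suc n) → ℤ
  s j = -1ℤ ^ toℕ j
  term : Matrix ℤ (suc n) → Fin (suc n) → ℤ
  term M j = s j * (M zero j * det (minor M j))
  ∣-sum : ∀ {m} {f : Vector ℤ m} → (∀ j → t ∣ f j) → t ∣ sum f
  ∣-sum {zero}  t∣f = divides 0ℤ refl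
  ∣-sum {suc m} t∣f = ∣m∣n⇒∣m+n (t∣f zero) (∣-sum (t∣f ∘ suc))
  lemma : ∀ s a x b y → s * ((a - b) * x) + s * b * (x - y) ≡ s * (a * x) + -1ℤ * (s * (b * y))
  lemma = solve-∀
  terms : ∀ j → t ∣ term A j + -1ℤ * term B j
  terms j = subst (t ∣_) (lemma (s j) (A zero j) (det (minor A j)) (B zero j) (det (minor B j)))
    (∣m∣n⇒∣m+n (∣n⇒∣m*n (s j) (∣m⇒∣m*n (det (minor A j)) (t∣ zero j)))
               (∣n⇒∣m*n (s j * B zero j) (det-mod t (minor A j) (minor B j) (λ i k → t∣ (suc i) (punchIn j k)))))
  eq : sum (λ j → term A j + -1ℤ * term B j) ≡ det A - det B
  eq = trans (∑-distrib-+ (term A) (λ j → -1ℤ * term B j))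
             (cong (_+_ (det A)) (trans (sym (*-distribˡ-sum -1ℤ (term B))) (-1*i≡-i (det B))))

-- The pencil `(1 + t) B - t 𝟙`

linear : ℤ → Matrix ℤ n → ℤ → Matrix ℤ n → Matrix ℤ n
linear a A b B i j = a * A i j + b * B i j

linear-cong : ∀ a b {A B C D : Matrix ℤ n} → A ≋ C → B ≋ D → linear a A b B ≋ linear a C b D
linear-cong a b A≋C B≋D .at i j = cong₂ (λ x y → a * x + b * y) (at A≋C i j) (at B≋D i j)

private
  sum-linear : ∀ a b (f g : Vector ℤ n) → sum (λ k → a * f k + b * g k) ≡ a * sum f + b * sum g
  sum-linear a b f g = trans (∑-distrib-+ (λ k → a * f k) (λ k → b * g k))
    (sym (cong₂ _+_ (*-distribˡ-sum a f) (*-distribˡ-sum b g)))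

opaque
  unfolding _⊗_

  linear-⊗ : ∀ a b (A B X : Matrix ℤ n) → linear a A b B ⊗ X ≋ linear a (A ⊗ X) b (B ⊗ X)
  linear-⊗ a b A B X .at i j = trans
    (sum-cong-≗ (λ k → lemma a (A i k) b (B i k) (X k j)))
    (sum-linear a b (λ k → A i k * X k j) (λ k → B i k * X k j))
    where
    lemma : ∀ a x b y z → (a * x + b * y) * z ≡ a * (x * z) + b * (y * z)
    lemma = solve-∀

  ⊗-linear : ∀ a b (X A B : Matrix ℤ n) → X ⊗ linear a A b B ≋ linear a (X ⊗ A) b (X ⊗ B)
  ⊗-linear a b X A B .at i j = trans
    (sum-cong-≗ (λ k → lemma a (A k j) b (B k j) (X i k)))
    (sum-linear a b (λ k → X i k * A k j) (λ k → X i k * B k j))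
    where
    lemma : ∀ a x b y z → z * (a * x + b * y) ≡ a * (z * x) + b * (z * y)
    lemma = solve-∀

-- With B = P ⊗ diag d ⊗ Q and W = Q ⊗ P, conjugation by Q turns (1 + t) B - t 𝟙 into
-- (1 + t) W ⊗ diag d - t 𝟙, whose j-th column is - t times a unit vector when d j = 0.
-- Dividing those columns by - t leaves pencil t.
module Pencil {B : Matrix ℤ n} {d : Vector ℤ n} (B∼ : B ∼ diag d) where
  W : Matrix ℤ n
  W = mat (right B∼) ⊗ mat (left B∼)

  N : Matrix ℤ n
  N i j = W i j * isNonZero (d j) + (1ℤ - isNonZero (d j)) * 𝟙 i j

  -- The coefficient of `𝟙 i j` is `- t` where `d j` is nonzero. Where `d j` is zero it is `1`, and
  -- the other summand vanishes.
  pencil : ℤ → Matrix ℤ n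
  pencil t i j = (1ℤ + t) * (W i j * d j) + (1ℤ - isNonZero (d j) - t * isNonZero (d j)) * 𝟙 i j

  private
    Q Q⁻¹ : Matrix ℤ n
    Q   = mat (right B∼)
    Q⁻¹ = inv (right B∼)

  conjugate : ∀ t → Q ⊗ linear (1ℤ + t) B (- t) 𝟙 ⊗ Q⁻¹ ≋ linear (1ℤ + t) (W ⊗ diag d) (- t) 𝟙
  conjugate t = ≋.trans
    (≋.trans (≋.∙-congʳ (⊗-linear (1ℤ + t) (- t) Q B 𝟙)) (linear-⊗ (1ℤ + t) (- t) (Q ⊗ B) (Q ⊗ 𝟙) Q⁻¹))
    (linear-cong (1ℤ + t) (- t) QBQ⁻¹ (≋.trans (≋.∙-congʳ (≋.identityʳ Q)) (mat⊗inv (right B∼))))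
    where
    P = mat (left B∼)
    QBQ⁻¹ : Q ⊗ B ⊗ Q⁻¹ ≋ W ⊗ diag d
    QBQ⁻¹ = ≋.trans (≋.∙-congʳ (≋.∙-congˡ (factors B∼))) (≋.trans (≋.assoc Q (P ⊗ diag d ⊗ Q) Q⁻¹)
      (≋.trans (≋.∙-congˡ (≋.cancelʳ (mat⊗inv (right B∼)) (P ⊗ diag d))) (≋.sym (≋.assoc Q P (diag d)))))

  pencil-zeroFactor : ∀ t → linear (1ℤ + t) (W ⊗ diag d) (- t) 𝟙 ≋ pencil t ⊗ diag (zeroFactor t ∘ d)
  pencil-zeroFactor t .at i j = trans
    (cong (λ z → (1ℤ + t) * z + - t * 𝟙 i j) (⊗-diag W d i j))
    (trans (scalar t (W i j) (d j) (𝟙 i j)) (sym (⊗-diag (pencil t) (zeroFactor t ∘ d) i j)))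
    where
    lemma₁ : ∀ t w e → (1ℤ + t) * (w * 0ℤ) + - t * e ≡ ((1ℤ + t) * (w * 0ℤ) + (1ℤ - 0ℤ - t * 0ℤ) * e) * - t
    lemma₁ = solve-∀
    lemma₂ : ∀ t w x e → (1ℤ + t) * (w * x) + - t * e ≡ ((1ℤ + t) * (w * x) + (1ℤ - 1ℤ - t * 1ℤ) * e) * 1ℤ
    lemma₂ = solve-∀
    scalar : ∀ t w x e → (1ℤ + t) * (w * x) + - t * e ≡
             ((1ℤ + t) * (w * x) + (1ℤ - isNonZero x - t * isNonZero x) * e) * zeroFactor t x
    scalar t w x e with x ≟ 0ℤ
    ... | yes refl = lemma₁ t w e
    ... | no  _    = lemma₂ t w x e

  pencil₀ : pencil 0ℤ ≋ N ⊗ diag (orOne ∘ d)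
  pencil₀ .at i j = trans (scalar (W i j) (d j) (𝟙 i j)) (sym (⊗-diag N (orOne ∘ d) i j))
    where
    lemma₁ : ∀ w e → (1ℤ + 0ℤ) * (w * 0ℤ) + (1ℤ - 0ℤ - 0ℤ * 0ℤ) * e ≡ (w * 0ℤ + (1ℤ - 0ℤ) * e) * 1ℤ
    lemma₁ = solve-∀
    lemma₂ : ∀ w x e → (1ℤ + 0ℤ) * (w * x) + (1ℤ - 1ℤ - 0ℤ * 1ℤ) * e ≡ (w * 1ℤ + (1ℤ - 1ℤ) * e) * x
    lemma₂ = solve-∀
    scalar : ∀ w x e → (1ℤ + 0ℤ) * (w * x) + (1ℤ - isNonZero x - 0ℤ * isNonZero x) * e ≡
             (w * isNonZero x + (1ℤ - isNonZero x) * e) * orOne x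
    scalar w x e with x ≟ 0ℤ
    ... | yes refl = lemma₁ w e
    ... | no  _    = lemma₂ w x e

  det-pencil : ∀ t → det (linear (1ℤ + t) B (- t) 𝟙) ≡ t ^ zeros d * (-1ℤ ^ zeros d * det (pencil t))
  det-pencil t = begin
    det G
      ≡⟨ *-identityʳ (det G) ⟨
    det G * 1ℤ
      ≡⟨ cong₂ _*_ (det-mat⊗ (right B∼) G) (det-mat (right B∼ ⁻¹SL)) ⟨
    det (Q ⊗ G) * det Q⁻¹
      ≡⟨ det-⊗ (Q ⊗ G) Q⁻¹ ⟨
    det (Q ⊗ G ⊗ Q⁻¹)
      ≡⟨ det-cong (≋.trans (conjugate t) (pencil-zeroFactor t)) ⟩
    det (pencil t ⊗ diag (zeroFactor t ∘ d))
      ≡⟨ det-⊗ (pencil t) (diag (zeroFactor t ∘ d)) ⟩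
    det (pencil t) * det (diag (zeroFactor t ∘ d))
      ≡⟨ cong (_*_ (det (pencil t))) (trans (det-diag (zeroFactor t ∘ d)) (product-zeroFactor t d)) ⟩
    det (pencil t) * (t ^ zeros d * -1ℤ ^ zeros d)
      ≡⟨ lemma (det (pencil t)) (t ^ zeros d) (-1ℤ ^ zeros d) ⟩
    t ^ zeros d * (-1ℤ ^ zeros d * det (pencil t)) ∎
    where
    open ≡-Reasoning
    G : Matrix ℤ n
    G = linear (1ℤ + t) B (- t) 𝟙
    lemma : ∀ a x y → a * (x * y) ≡ x * (y * a)
    lemma = solve-∀

  leading : ℤ
  leading = -1ℤ ^ zeros d * (det N * product (orOne ∘ d))

  -- `pencil t` and `pencil 0ℤ` agree entrywise modulo `t`, which avoids expanding the determinant
  -- in powers of `t`.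
  det-pencil-mod : ∀ t → t ∣ -1ℤ ^ zeros d * det (pencil t) - leading
  det-pencil-mod t = subst (t ∣_)
    (trans (lemma (-1ℤ ^ zeros d) (det (pencil t)) (det (pencil 0ℤ)))
           (cong (λ z → -1ℤ ^ zeros d * det (pencil t) - -1ℤ ^ zeros d * z) det-pencil₀))
    (∣n⇒∣m*n (-1ℤ ^ zeros d) (det-mod t (pencil t) (pencil 0ℤ)
      λ i j → divides (W i j * d j - isNonZero (d j) * 𝟙 i j) (entry t (W i j * d j) (isNonZero (d j)) (𝟙 i j))))
    where
    lemma : ∀ s x y → s * (x - y) ≡ s * x - s * y
    lemma = solve-∀
    entry : ∀ t w k e → ((1ℤ + t) * w + (1ℤ - k - t * k) * e) - ((1ℤ + 0ℤ) * w + (1ℤ - k - 0ℤ * k) * e) ≡ (w - k * e) * t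
    entry = solve-∀
    det-pencil₀ : det (pencil 0ℤ) ≡ det N * product (orOne ∘ d)
    det-pencil₀ = trans (det-cong pencil₀)
      (trans (det-⊗ N (diag (orOne ∘ d))) (cong (_*_ (det N)) (det-diag (orOne ∘ d))))

-- Clearing denominators

module ℚSum = SemiringSum (CommutativeRing.semiring ℚ.+-*-commutativeRing)

toℚᵘ-toℚ : ∀ i → ℚ.toℚᵘ (toℚ i) ℚᵘ.≃ ℚᵘ.mkℚᵘ i 0
toℚᵘ-toℚ i = ℚ.toℚᵘ-fromℚᵘ (ℚᵘ.mkℚᵘ i 0)

toℚ-injective : ∀ {i j} → toℚ i ≡ toℚ j → i ≡ j
toℚ-injective {i} {j} eq
  with ℚᵘ.*≡* i1≡j1 ← ℚᵘ.≃-trans (ℚᵘ.≃-sym (toℚᵘ-toℚ i)) (ℚᵘ.≃-trans (ℚᵘ.≃-reflexive (cong ℚ.toℚᵘ eq)) (toℚᵘ-toℚ j))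
  = *-cancelʳ-≡ i j 1ℤ i1≡j1

toℚ-* : ∀ i j → toℚ (i * j) ≡ toℚ i ℚ.* toℚ j
toℚ-* i j = ℚ.toℚᵘ-injective (ℚᵘ.≃-trans (toℚᵘ-toℚ (i * j)) (ℚᵘ.≃-sym
  (ℚᵘ.≃-trans (ℚ.toℚᵘ-homo-* (toℚ i) (toℚ j)) (ℚᵘ.*-cong (toℚᵘ-toℚ i) (toℚᵘ-toℚ j)))))

toℚ-sum : (f : Vector ℤ n) → toℚ (sum f) ≡ ℚSum.sum (toℚ ∘ f)
toℚ-sum {zero}  f = refl
toℚ-sum {suc n} f = trans (homo (λ _ → f zero) (λ _ → sum (f ∘ suc)) zero)
                          (cong (toℚ (f zero) ℚ.+_) (toℚ-sum (f ∘ suc)))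
  where open GroupHomomorphism (ℤ⊆ℚ 1) using (homo)

denominator-* : ∀ q → toℚ (ℚ.↧ q) ℚ.* q ≡ toℚ (ℚ.↥ q)
denominator-* q@record{} = ℚ.toℚᵘ-injective (ℚᵘ.≃-trans (ℚ.toℚᵘ-homo-* (toℚ (ℚ.↧ q)) q)
  (ℚᵘ.≃-trans (ℚᵘ.*-congʳ (toℚᵘ-toℚ (ℚ.↧ q))) (ℚᵘ.≃-trans (ℚᵘ.*≡* (lemma (ℚ.↧ q) (ℚ.↥ q))) (ℚᵘ.≃-sym (toℚᵘ-toℚ (ℚ.↥ q))))))
  where
  lemma : ∀ d n → d * n * 1ℤ ≡ n * (1ℤ * d)
  lemma = solve-∀

commonDenominator : (q : Vector ℚ n) → ∃[ k ] (k ≢ 0ℤ × Σ[ x ∈ Vector ℤ n ] (∀ j → toℚ k ℚ.* q j ≡ toℚ (x j)))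
commonDenominator {zero}  q = 1ℤ , (λ ()) , (λ ()) , λ ()
commonDenominator {suc n} q with commonDenominator (q ∘ suc)
... | k , k≢0 , x , kq≡x = d * k , dk≢0 , y , dkq≡y
  where
  d : ℤ
  d = ℚ.↧ (q zero)
  dk≢0 : d * k ≢ 0ℤ
  dk≢0 dk≡0 with i*j≡0⇒i≡0∨j≡0 d dk≡0
  ... | inj₁ ()
  ... | inj₂ k≡0 = k≢0 k≡0
  y : Vector ℤ (suc n)
  y zero    = k * ℚ.↥ (q zero)
  y (suc j) = d * x j
  dkq≡y : ∀ j → toℚ (d * k) ℚ.* q j ≡ toℚ (y j)
  dkq≡y zero = begin
    toℚ (d * k) ℚ.* q zero           ≡⟨ cong (ℚ._* q zero) (trans (cong toℚ (*-comm d k)) (toℚ-* k d)) ⟩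
    toℚ k ℚ.* toℚ d ℚ.* q zero       ≡⟨ ℚ.*-assoc (toℚ k) (toℚ d) (q zero) ⟩
    toℚ k ℚ.* (toℚ d ℚ.* q zero)     ≡⟨ cong (toℚ k ℚ.*_) (denominator-* (q zero)) ⟩
    toℚ k ℚ.* toℚ (ℚ.↥ (q zero))     ≡⟨ toℚ-* k (ℚ.↥ (q zero)) ⟨
    toℚ (k * ℚ.↥ (q zero))           ∎
    where open ≡-Reasoning
  dkq≡y (suc j) = begin
    toℚ (d * k) ℚ.* q (suc j)        ≡⟨ cong (ℚ._* q (suc j)) (toℚ-* d k) ⟩
    toℚ d ℚ.* toℚ k ℚ.* q (suc j)    ≡⟨ ℚ.*-assoc (toℚ d) (toℚ k) (q (suc j)) ⟩
    toℚ d ℚ.* (toℚ k ℚ.* q (suc j))  ≡⟨ cong (toℚ d ℚ.*_) (kq≡x j) ⟩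
    toℚ d ℚ.* toℚ (x j)              ≡⟨ toℚ-* d (x j) ⟨
    toℚ (d * x j)                    ∎
    where open ≡-Reasoning

reciprocal : ∀ k → ∃[ p ] (p ℚ.* toℚ (+ suc k) ≡ ℚ.1ℚ)
reciprocal k = ℚ.fromℚᵘ (ℚᵘ.mkℚᵘ 1ℤ k) , ℚ.toℚᵘ-injective
  (ℚᵘ.≃-trans (ℚ.toℚᵘ-homo-* (ℚ.fromℚᵘ (ℚᵘ.mkℚᵘ 1ℤ k)) (toℚ (+ suc k)))
    (ℚᵘ.≃-trans (ℚᵘ.*-cong (ℚ.toℚᵘ-fromℚᵘ (ℚᵘ.mkℚᵘ 1ℤ k)) (toℚᵘ-toℚ (+ suc k)))
                (ℚᵘ.*≡* (lemma (+ suc k)))))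
  where
  lemma : ∀ d → 1ℤ * d * 1ℤ ≡ 1ℤ * (d * 1ℤ)
  lemma = solve-∀

InRationalImage : Matrix ℤ n → Vector ℤ n → Set
InRationalImage {n} B v = Σ[ q ∈ Vector ℚ n ] (ℚMod.apply (λ i j → toℚ (B i j)) q ≗ toℚ ∘ v)

apply-scale : ∀ (B : Matrix ℤ n) k x y → (∀ j → k ℚ.* x j ≡ y j) →
              ∀ i → ℚMod.apply (λ i j → toℚ (B i j)) y i ≡ k ℚ.* ℚMod.apply (λ i j → toℚ (B i j)) x i
apply-scale B k x y kx≡y i = trans
  (ℚSum.sum-cong-≗ (λ j → trans (cong (toℚ (B i j) ℚ.*_) (sym (kx≡y j))) (x∙yz≈y∙xz (toℚ (B i j)) k (x j))))
  (sym (ℚSum.*-distribˡ-sum k (λ j → toℚ (B i j) ℚ.* x j)))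
  where open CommutativeSemigroupProperties (CommutativeRing.*-commutativeSemigroup ℚ.+-*-commutativeRing) using (x∙yz≈y∙xz)

toℚ-apply : (B : Matrix ℤ n) (x : Vector ℤ n) → ∀ i →
            toℚ (apply B x i) ≡ ℚMod.apply (λ i j → toℚ (B i j)) (toℚ ∘ x) i
toℚ-apply B x i = trans (toℚ-sum (λ j → B i j * x j)) (ℚSum.sum-cong-≗ (λ j → toℚ-* (B i j) (x j)))

-- This turns membership in `𝓛` into the condition that defines torsion in the cokernel: some
-- nonzero multiple lies in the integral image.
rationalImage⇒ : (B : Matrix ℤ n) (v : Vector ℤ n) → InRationalImage B v →
                 ∃[ k ] (k ≢ 0ℤ × InImage B (λ i → k * v i))
rationalImage⇒ B v (q , Bq≡v) with commonDenominator q
... | k , k≢0 , x , kq≡x = k , k≢0 , x , λ i → toℚ-injective (begin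
    toℚ (apply B x i)
      ≡⟨ toℚ-apply B x i ⟩
    ℚMod.apply (λ i j → toℚ (B i j)) (toℚ ∘ x) i
      ≡⟨ apply-scale B (toℚ k) q (toℚ ∘ x) kq≡x i ⟩
    toℚ k ℚ.* ℚMod.apply (λ i j → toℚ (B i j)) q i
      ≡⟨ cong (toℚ k ℚ.*_) (Bq≡v i) ⟩
    toℚ k ℚ.* toℚ (v i)
      ≡⟨ toℚ-* k (v i) ⟨
    toℚ (k * v i) ∎)
  where open ≡-Reasoning

⇒rationalImage : (B : Matrix ℤ n) (v : Vector ℤ n) → ∀ k → InImage B (λ i → + suc k * v i) → InRationalImage B v
⇒rationalImage B v k (x , Bx≡kv) with reciprocal k
... | p , pk≡1 = (λ j → p ℚ.* toℚ (x j)) , λ i → begin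
    ℚMod.apply (λ i j → toℚ (B i j)) (λ j → p ℚ.* toℚ (x j)) i
      ≡⟨ apply-scale B p (toℚ ∘ x) (λ j → p ℚ.* toℚ (x j)) (λ _ → refl) i ⟩
    p ℚ.* ℚMod.apply (λ i j → toℚ (B i j)) (toℚ ∘ x) i
      ≡⟨ cong (p ℚ.*_) (trans (sym (toℚ-apply B x i)) (trans (cong toℚ (Bx≡kv i)) (toℚ-* (+ suc k) (v i)))) ⟩
    p ℚ.* (toℚ (+ suc k) ℚ.* toℚ (v i))
      ≡⟨ ℚ.*-assoc p (toℚ (+ suc k)) (toℚ (v i)) ⟨
    p ℚ.* toℚ (+ suc k) ℚ.* toℚ (v i)
      ≡⟨ cong (ℚ._* toℚ (v i)) pk≡1 ⟩
    ℚ.1ℚ ℚ.* toℚ (v i)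
      ≡⟨ ℚ.*-identityˡ (toℚ (v i)) ⟩
    toℚ (v i) ∎
  where open ≡-Reasoning

-- Bowen–Franks groups

coker : Matrix ℤ n → AbGroup
coker {n} B = cokernel {free n} {free n} (matrixHom B)

module _ (B : Matrix ℤ n) where
  open AbelianGroup (coker B) using (rawMonoid)
  open RawMonoidDefs rawMonoid using () renaming (_×_ to _×ℕ_; sum to sumᶜ)

  -- The cokernel keeps the operations of ℤⁿ, so these equations hold entrywise and not just modulo
  -- the image.
  ×ℕ-entry : ∀ k x i → (k ×ℕ x) i ≡ + k * x i
  ×ℕ-entry zero    x i = sym (*-zeroˡ (x i))
  ×ℕ-entry (suc k) x i = trans (cong (_+_ (x i)) (×ℕ-entry k x i)) (sym (suc-* (+ k) (x i)))

  ·ℤ-entry : ∀ c x i → (_·ℤ_ (coker B) c x) i ≡ c * x i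
  ·ℤ-entry (+ k)    x i = ×ℕ-entry k x i
  ·ℤ-entry -[1+ k ] x i = trans (cong -_ (×ℕ-entry (suc k) x i)) (neg-distribˡ-* (+ suc k) (x i))

  sumᶜ-entry : (f : Fin m → Vector ℤ n) → ∀ i → sumᶜ f i ≡ sum (λ j → f j i)
  sumᶜ-entry {zero}  f i = refl
  sumᶜ-entry {suc m} f i = cong (_+_ (f zero i)) (sumᶜ-entry (f ∘ suc) i)

apply-sum : (A : Matrix ℤ n) (c : Vector ℤ m) (x : Fin m → Vector ℤ n) → ∀ i →
            apply A (λ k → sum (λ j → c j * x j k)) i ≡ sum (λ j → apply A (x j) i * c j)
apply-sum A c x i = begin
  sum (λ k → A i k * sum (λ j → c j * x j k))
    ≡⟨ sum-cong-≗ (λ k → *-distribˡ-sum (A i k) (λ j → c j * x j k)) ⟩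
  sum (λ k → sum (λ j → A i k * (c j * x j k)))
    ≡⟨ ∑-comm (λ k j → A i k * (c j * x j k)) ⟩
  sum (λ j → sum (λ k → A i k * (c j * x j k)))
    ≡⟨ sum-cong-≗ (λ j → sum-cong-≗ (λ k → lemma (A i k) (c j) (x j k))) ⟩
  sum (λ j → sum (λ k → A i k * x j k * c j))
    ≡⟨ sum-cong-≗ (λ j → *-distribʳ-sum (c j) (λ k → A i k * x j k)) ⟨
  sum (λ j → apply A (x j) i * c j) ∎
  where
  open ≡-Reasoning
  lemma : ∀ a c x → a * (c * x) ≡ a * x * c
  lemma = solve-∀

apply-*ₗ : (A : Matrix ℤ n) (k : ℤ) (x : Vector ℤ n) → ∀ i → apply A (λ j → k * x j) i ≡ k * apply A x i
apply-*ₗ A k x i = trans (sum-cong-≗ (λ j → lemma (A i j) k (x j))) (sym (*-distribˡ-sum k (λ j → A i j * x j)))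
  where
  lemma : ∀ a k x → a * (k * x) ≡ k * (a * x)
  lemma = solve-∀

isNonZero-0 : ∀ {x} → x ≡ 0ℤ → isNonZero x ≡ 0ℤ
isNonZero-0 refl = refl

isNonZero-≢ : ∀ {x} → x ≢ 0ℤ → isNonZero x ≡ 1ℤ
isNonZero-≢ {x} x≢0 with x ≟ 0ℤ
... | yes x≡0 = contradiction x≡0 x≢0
... | no  _   = refl

orOne-≢ : ∀ {x} → x ≢ 0ℤ → orOne x ≡ x
orOne-≢ {x} x≢0 with x ≟ 0ℤ
... | yes x≡0 = contradiction x≡0 x≢0
... | no  _   = refl

module BowenFranks {B : Matrix ℤ n} {d : Vector ℤ n} (B∼ : B ∼ diag d) where
  open Diagonalised B∼
  open Pencil B∼ using (W; N)

  -- Every nonzero `d i` divides `κ`, so this one multiplier carries the whole saturation into the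
  -- image.
  κ : ℤ
  κ = product (orOne ∘ d)

  κ≢0 : κ ≢ 0ℤ
  κ≢0 = product-orOne≢0 d

  restrict : Vector ℤ n → Vector ℤ n
  restrict x i = isNonZero (d i) * x i

  -- The saturation ℤⁿ ∩ B(ℚⁿ), in the coordinates given by P.
  Saturated : Vector ℤ n → Set
  Saturated v = ∀ i → d i ≡ 0ℤ → P⁻¹ v i ≡ 0ℤ

  -- Where `d i` is zero, divisibility by `d i` says that `k * P⁻¹ v i` vanishes, and `k` can be
  -- cancelled.
  multiple⇒saturated : ∀ v k → k ≢ 0ℤ → InImage B (λ i → k * v i) → Saturated v
  multiple⇒saturated v k k≢0 kv∈ i dᵢ≡0 = [ (λ k≡0 → contradiction k≡0 k≢0) , (λ eq → eq) ]′
    (i*j≡0⇒i≡0∨j≡0 k (trans (sym (apply-*ₗ (inv (left B∼)) k v i)) (0∣⇒≡0 (subst (_∣ P⁻¹ (λ i → k * v i) i) dᵢ≡0 (image⇒∣ kv∈ i)))))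

  saturated⇒multiple : ∀ v → Saturated v → InImage B (λ i → + ∣ κ ∣ * v i)
  saturated⇒multiple v sat = ∣⇒image λ i →
    subst (d i ∣_) (sym (apply-*ₗ (inv (left B∼)) (+ ∣ κ ∣) v i)) (divisible i)
    where
    divisible : ∀ i → d i ∣ + ∣ κ ∣ * P⁻¹ v i
    divisible i with d i ≟ 0ℤ
    ... | yes dᵢ≡0 = divides 0ℤ (trans (cong (+ ∣ κ ∣ *_) (sat i dᵢ≡0)) (*-zeroʳ (+ ∣ κ ∣)))
    ... | no  dᵢ≢0 = ∣m⇒∣m*n (P⁻¹ v i) (subst (_∣ + ∣ κ ∣) (orOne-≢ dᵢ≢0)
                       (∣-trans (entry∣product (orOne ∘ d) i) m∣∣m∣))

  saturated-P-restrict : ∀ y → Saturated (P (restrict y))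
  saturated-P-restrict y i dᵢ≡0 =
    trans (P⁻¹-P (restrict y) i) (trans (cong (_* y i) (isNonZero-0 dᵢ≡0)) (*-zeroˡ (y i)))

  restrict-saturated : ∀ v → Saturated v → restrict (P⁻¹ v) ≗ P⁻¹ v
  restrict-saturated v sat i = go (d i ≟ 0ℤ)
    where
    go : _ → restrict (P⁻¹ v) i ≡ P⁻¹ v i
    go (yes dᵢ≡0) = trans (trans (cong (_* P⁻¹ v i) (isNonZero-0 dᵢ≡0)) (*-zeroˡ (P⁻¹ v i))) (sym (sat i dᵢ≡0))
    go (no  dᵢ≢0) = trans (cong (_* P⁻¹ v i) (isNonZero-≢ dᵢ≢0)) (*-identityˡ (P⁻¹ v i))

  -- With more than `zeros d` vectors, some nontrivial combination has vanishing coordinates at all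
  -- zeros of `d`. It is then saturated, and `∣ κ ∣` times it is zero in the cokernel.
  independent⇒≤zeros : ∀ {ρ} (x : Fin ρ → Vector ℤ n) → ℤ-Independent (coker B) x → ρ ≤ zeros d
  independent⇒≤zeros {ρ} x independent = ℕ.≮⇒≥ λ z<ρ → refute (dependent (λ i j → P⁻¹ (x j) i) d z<ρ)
    where
    open AbelianGroup (coker B) using (_≈_; ε; rawMonoid)
    open RawMonoidDefs rawMonoid using () renaming (sum to sumᶜ)
    module _ (c : Vector ℤ ρ) (relation : ∀ i → d i ≡ 0ℤ → sum (λ j → P⁻¹ (x j) i * c j) ≡ 0ℤ) where
      v : Vector ℤ n
      v k = sum (λ j → c j * x j k)
      combination : Vector ℤ n
      combination = sumᶜ (λ j → _·ℤ_ (coker B) (+ ∣ κ ∣ * c j) (x j))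
      κv≗combination : ∀ i → + ∣ κ ∣ * v i ≡ combination i
      κv≗combination i = begin
        + ∣ κ ∣ * sum (λ j → c j * x j i)
          ≡⟨ *-distribˡ-sum (+ ∣ κ ∣) (λ j → c j * x j i) ⟩
        sum (λ j → + ∣ κ ∣ * (c j * x j i))
          ≡⟨ sum-cong-≗ (λ j → trans (sym (*-assoc (+ ∣ κ ∣) (c j) (x j i))) (sym (·ℤ-entry B (+ ∣ κ ∣ * c j) (x j) i))) ⟩
        sum (λ j → _·ℤ_ (coker B) (+ ∣ κ ∣ * c j) (x j) i)
          ≡⟨ sumᶜ-entry B (λ j → _·ℤ_ (coker B) (+ ∣ κ ∣ * c j) (x j)) i ⟨
        combination i ∎
        where open ≡-Reasoning
      combination≈ε : combination ≈ ε
      combination≈ε =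
        let z , Bz≗ = saturated⇒multiple v (λ i dᵢ≡0 → trans (apply-sum (inv (left B∼)) c x i) (relation i dᵢ≡0)) in
        z , tt , λ i → trans (Bz≗ i) (trans (κv≗combination i) (sym (+-identityʳ (combination i))))
    refute : ¬ Dependent (λ i j → P⁻¹ (x j) i) d
    refute (c , (j , cⱼ≢0) , relation) =
      [ (λ ∣κ∣≡0 → κ≢0 (∣i∣≡0⇒i≡0 (+-injective ∣κ∣≡0))) , cⱼ≢0 ]′
        (i*j≡0⇒i≡0∨j≡0 (+ ∣ κ ∣) (independent (λ j → + ∣ κ ∣ * c j) (combination≈ε c relation) j))

  torsionGroup : AbGroup
  torsionGroup = subgroupAsGroup {coker B} (torsion (coker B))

  -- A coordinate with `d i ≡ 0ℤ` is erased by `restrict` in the group and by the modulus 1 from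
  -- `orOne` in the lattice, so a square matrix of full size can present the torsion.
  torsion-cardinality : HasCardinality torsionGroup ∣ det (diag (orOne ∘ d)) ∣
  torsion-cardinality = coker-cardinality torsionGroup (diag (orOne ∘ d))
    (λ eq → κ≢0 (trans (sym (det-diag (orOne ∘ d))) eq)) f s f-s image⇒≈ ≈⇒image
    where
    open AbelianGroup torsionGroup using (Carrier; _≈_)
    saturated⇒torsion : ∀ v → Saturated v → Subgroup._∈ (torsion (coker B)) v
    saturated⇒torsion v sat =
      let z , Bz≗ = saturated⇒multiple v sat in
      ∣ κ ∣ , (λ ∣κ∣≡0 → κ≢0 (∣i∣≡0⇒i≡0 ∣κ∣≡0)) , z , tt ,
      λ i → trans (Bz≗ i) (trans (sym (×ℕ-entry B ∣ κ ∣ v i)) (sym (+-identityʳ _)))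
    torsion⇒saturated : ∀ v → Subgroup._∈ (torsion (coker B)) v → Saturated v
    torsion⇒saturated v (k , k≢0 , z , _ , Bz≗) = multiple⇒saturated v (+ k) (λ k≡0 → k≢0 (+-injective k≡0))
      (z , λ i → trans (Bz≗ i) (trans (+-identityʳ _) (×ℕ-entry B k v i)))
    f : Vector ℤ n → Carrier
    f y = P (restrict y) , saturated⇒torsion (P (restrict y)) (saturated-P-restrict y)
    s : Carrier → Vector ℤ n
    s (v , _) = P⁻¹ v
    image-≗ : ∀ {v w} → v ≗ w → InImage B (v − w)
    image-≗ v≗w = (λ _ → 0ℤ) , λ i → trans (GroupHomomorphism.ε-homo (matrixHom B) i) (sym (i≡j⇒i-j≡0 (v≗w i)))
    f-s : ∀ g → f (s g) ≈ g
    f-s (v , v∈) =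
      let z , Bz≗ = image-≗ {P (restrict (P⁻¹ v))} {v}
                      (λ i → trans (P-cong (restrict-saturated v (torsion⇒saturated v v∈)) i) (P-P⁻¹ v i)) in
      z , tt , Bz≗
    P⁻¹-difference : ∀ x y i → P⁻¹ (P (restrict x) − P (restrict y)) i ≡ isNonZero (d i) * (x i - y i)
    P⁻¹-difference x y i = trans (apply-− (inv (left B∼)) (P (restrict x)) (P (restrict y)) i)
      (trans (cong₂ _-_ (P⁻¹-P (restrict x) i) (P⁻¹-P (restrict y) i)) (lemma (isNonZero (d i)) (x i) (y i)))
      where
      lemma : ∀ e x y → e * x - e * y ≡ e * (x - y)
      lemma = solve-∀
    entry : ∀ d w → d ∣ isNonZero d * (orOne d * w)
    entry d w with d ≟ 0ℤ
    ... | yes refl = divides 0ℤ (*-zeroˡ (1ℤ * w))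
    ... | no  _    = divides w (lemma d w)
      where
      lemma : ∀ d w → 1ℤ * (d * w) ≡ w * d
      lemma = solve-∀
    image⇒≈ : ∀ x y → InImage (diag (orOne ∘ d)) (x − y) → f x ≈ f y
    image⇒≈ x y (w , Dw≗) =
      let z , Bz≗ = ∣⇒image {P (restrict x) − P (restrict y)} λ i →
            subst (d i ∣_) (sym (P⁻¹-difference x y i))
              (subst (λ u → d i ∣ isNonZero (d i) * u) (trans (sym (apply-diag (orOne ∘ d) w i)) (Dw≗ i)) (entry (d i) (w i))) in
      z , tt , Bz≗
    ≈⇒image : ∀ x y → f x ≈ f y → InImage (diag (orOne ∘ d)) (x − y)
    ≈⇒image x y (z , _ , Bz≗) = w , λ i → trans (apply-diag (orOne ∘ d) w i) (proj₂ (quotients i))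
      where
      solve : ∀ d u → d ∣ isNonZero d * u → ∃[ q ] (orOne d * q ≡ u)
      solve d u d∣ with d ≟ 0ℤ
      ... | yes _ = u , *-identityˡ u
      solve d u (divides q eq) | no _ = q , trans (*-comm d q) (trans (sym eq) (*-identityˡ u))
      quotients : ∀ i → ∃[ q ] (orOne (d i) * q ≡ x i - y i)
      quotients i = solve (d i) (x i - y i) (subst (d i ∣_) (P⁻¹-difference x y i) (image⇒∣ (z , Bz≗) i))
      w : Vector ℤ n
      w = proj₁ ∘ quotients

  rationalImage⇒saturated : ∀ v → InRationalImage B v → Saturated v
  rationalImage⇒saturated v v∈ = let k , k≢0 , kv∈ = rationalImage⇒ B v v∈ in multiple⇒saturated v k k≢0 kv∈

  saturated⇒rationalImage : ∀ v → Saturated v → InRationalImage B v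
  saturated⇒rationalImage v sat = positive ∣ κ ∣ (κ≢0 ∘ ∣i∣≡0⇒i≡0) (saturated⇒multiple v sat)
    where
    positive : ∀ k → k ≢ 0 → InImage B (λ i → + k * v i) → InRationalImage B v
    positive zero    k≢0 _   = contradiction refl k≢0
    positive (suc k) _   kv∈ = ⇒rationalImage B v k kv∈

  -- Splitting `z` by the support of `d`: one part is sent through `W = Q P`, the other is kept.
  apply-N : ∀ z i → apply N z i ≡ Q (P (restrict z)) i + (1ℤ - isNonZero (d i)) * z i
  apply-N z i = begin
    sum (λ j → (W i j * e j + (1ℤ - e j) * 𝟙 i j) * z j)
      ≡⟨ sum-cong-≗ (λ j → lemma (W i j) (e j) (𝟙 i j) (z j)) ⟩
    sum (λ j → W i j * (e j * z j) + 𝟙 i j * ((1ℤ - e j) * z j))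
      ≡⟨ ∑-distrib-+ (λ j → W i j * (e j * z j)) (λ j → 𝟙 i j * ((1ℤ - e j) * z j)) ⟩
    apply W (restrict z) i + apply 𝟙 (λ j → (1ℤ - e j) * z j) i
      ≡⟨ cong₂ _+_ (apply-⊗ (mat (right B∼)) (mat (left B∼)) (restrict z) i) (apply-𝟙 (λ j → (1ℤ - e j) * z j) i) ⟩
    Q (P (restrict z)) i + (1ℤ - e i) * z i ∎
    where
    open ≡-Reasoning
    e : Vector ℤ n
    e = isNonZero ∘ d
    lemma : ∀ w e δ z → (w * e + (1ℤ - e) * δ) * z ≡ w * (e * z) + δ * ((1ℤ - e) * z)
    lemma = solve-∀

  -- Applying P⁻¹, this says that D (x - y) = D Q P z for some z supported on the
  -- nonzero diagonal entries.
  InImage-N⇒ : ∀ x y → InImage N (x − y) →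
               Σ[ w ∈ Vector ℤ n ] (Saturated w × apply B w ≗ P (λ i → d i * x i) − P (λ i → d i * y i))
  InImage-N⇒ x y (z , Nz≗) = w , saturated-P-restrict z , λ i → begin
    apply B w i
      ≡⟨ apply-PDQ w i ⟩
    P (λ i → d i * Q w i) i
      ≡⟨ P-cong (λ j → trans (scalar (d j) (Q w j) (z j)) (trans (cong (d j *_) (trans (sym (apply-N z j)) (Nz≗ j)))
                             (lemma (d j) (x j) (y j)))) i ⟩
    P ((λ i → d i * x i) − (λ i → d i * y i)) i
      ≡⟨ apply-− (mat (left B∼)) (λ i → d i * x i) (λ i → d i * y i) i ⟩
    (P (λ i → d i * x i) − P (λ i → d i * y i)) i ∎
    where
    open ≡-Reasoning
    w : Vector ℤ n
    w = P (restrict z)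
    lemma : ∀ d x y → d * (x - y) ≡ d * x - d * y
    lemma = solve-∀
    lemma₁ : ∀ d h z → d * h ≡ d * (h + (1ℤ - 1ℤ) * z)
    lemma₁ = solve-∀
    scalar : ∀ d h z → d * h ≡ d * (h + (1ℤ - isNonZero d) * z)
    scalar d h z with d ≟ 0ℤ
    ... | yes refl = trans (*-zeroˡ h) (sym (*-zeroˡ (h + (1ℤ - 0ℤ) * z)))
    ... | no  _    = lemma₁ d h z

  -- The hypothesis gives `D Q w = D (x - y)`, so `Q w` and `x - y` agree where `d` is nonzero.
  -- There `z` is `P⁻¹ w`; at the zeros of `d` it is the remaining discrepancy between `x - y` and
  -- `Q w`.
  ⇒InImage-N : ∀ x y w → Saturated w → apply B w ≗ P (λ i → d i * x i) − P (λ i → d i * y i) → InImage N (x − y)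
  ⇒InImage-N x y w sat Bw≗ = z , λ i → trans (apply-N z i) (trans
    (cong (_+ (1ℤ - isNonZero (d i)) * z i) (Qw i)) (assemble (d i) (Q w i) (P⁻¹ w i) (x i - y i) (dQw i)))
    where
    glue : ℤ → ℤ → ℤ → ℤ → ℤ
    glue d h u v = isNonZero d * u + (1ℤ - isNonZero d) * (v - h)
    z : Vector ℤ n
    z i = glue (d i) (Q w i) (P⁻¹ w i) (x i - y i)
    dQw : ∀ i → d i * Q w i ≡ d i * (x i - y i)
    dQw i = begin
      d i * Q w i
        ≡⟨ P⁻¹-apply w i ⟨
      P⁻¹ (apply B w) i
        ≡⟨ P⁻¹-cong Bw≗ i ⟩
      P⁻¹ (P (λ i → d i * x i) − P (λ i → d i * y i)) i
        ≡⟨ apply-− (inv (left B∼)) (P (λ i → d i * x i)) (P (λ i → d i * y i)) i ⟩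
      P⁻¹ (P (λ i → d i * x i)) i - P⁻¹ (P (λ i → d i * y i)) i
        ≡⟨ cong₂ _-_ (P⁻¹-P (λ i → d i * x i) i) (P⁻¹-P (λ i → d i * y i) i) ⟩
      d i * x i - d i * y i
        ≡⟨ lemma (d i) (x i) (y i) ⟩
      d i * (x i - y i) ∎
      where
      open ≡-Reasoning
      lemma : ∀ d x y → d * x - d * y ≡ d * (x - y)
      lemma = solve-∀
    restrict-glue : ∀ d h u v → isNonZero d * u ≡ u → isNonZero d * glue d h u v ≡ u
    restrict-glue d h u v eu≡u with d ≟ 0ℤ
    ... | yes _ = trans (*-zeroˡ (0ℤ * u + (1ℤ - 0ℤ) * (v - h))) (trans (sym (*-zeroˡ u)) eu≡u)
    ... | no  _ = lemma u (v - h)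
      where
      lemma : ∀ u x → 1ℤ * (1ℤ * u + (1ℤ - 1ℤ) * x) ≡ u
      lemma = solve-∀
    Qw : ∀ i → Q (P (restrict z)) i ≡ Q w i
    Qw = apply-cong (mat (right B∼)) λ i → trans
      (P-cong (λ j → restrict-glue (d j) (Q w j) (P⁻¹ w j) (x j - y j) (restrict-saturated w sat j)) i)
      (P-P⁻¹ w i)
    assemble : ∀ d h u v → d * h ≡ d * v → h + (1ℤ - isNonZero d) * glue d h u v ≡ v
    assemble d h u v dh≡dv with d ≟ 0ℤ
    ... | yes _   = lemma h u v
      where
      lemma : ∀ h u v → h + (1ℤ - 0ℤ) * (0ℤ * u + (1ℤ - 0ℤ) * (v - h)) ≡ v
      lemma = solve-∀
    ... | no  d≢0 = trans (lemma h (1ℤ * u + (1ℤ - 1ℤ) * (v - h))) (*-cancelˡ-≡ d h v {{≢-nonZero d≢0}} dh≡dv)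
      where
      lemma : ∀ h x → h + (1ℤ - 1ℤ) * x ≡ h
      lemma = solve-∀

-- The digraph: characteristic polynomial, `𝓡` and the multiplier

does-≟ : (v w : Fin n) → (if does (v Fin.≟ w) then 1ℤ else 0ℤ) ≡ 𝟙 w v
does-≟ zero    zero    = refl
does-≟ zero    (suc w) = refl
does-≟ (suc v) zero    = refl
does-≟ (suc v) (suc w) = does-≟ v w

-- The torsion order is an absolute value, whereas `g*` contains the signed determinant; this unit
-- reconciles them.
unit-* : ∀ i → ∃[ ε ] (∣ ε ∣ ≡ 1 × ε * + ∣ i ∣ ≡ i)
unit-* (+ k)    = 1ℤ  , refl , *-identityˡ (+ k)
unit-* -[1+ k ] = -1ℤ , refl , -1*i≡-i (+ suc k)

∣-1^k∣≡1 : ∀ k → ∣ -1ℤ ^ k ∣ ≡ 1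
∣-1^k∣≡1 zero    = refl
∣-1^k∣≡1 (suc k) = trans (abs-* -1ℤ (-1ℤ ^ k)) (trans (ℕ.*-identityˡ ∣ -1ℤ ^ k ∣) (∣-1^k∣≡1 k))

module _ (X : Digraph) where
  open Digraph X

  eval-g : ∀ t → eval (taylor₁ g) t ≡ det (linear (1ℤ + t) 𝓑𝓕-matrix (- t) 𝟙)
  eval-g t = trans (eval-taylor₁ g t) (trans (eval-det entries (1ℤ + t)) (det-cong (entrywise eval-entry)))
    where
    entries : Matrix ℤ[u] #V
    entries w v = const (𝓘-matrix w v) +ₚ (-ₚ (const (𝓐-matrix w v) *ₚ u))
    lemma : ∀ i a t → i + - (a * (0ℤ + (1ℤ + t) * (1ℤ + (1ℤ + t) * 0ℤ))) ≡ (1ℤ + t) * (i - a) + - t * i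
    lemma = solve-∀
    eval-entry : ∀ w v → eval (entries w v) (1ℤ + t) ≡ (1ℤ + t) * 𝓑𝓕-matrix w v + - t * 𝟙 w v
    eval-entry w v = begin
      eval (const I +ₚ (-ₚ (const A *ₚ u))) (1ℤ + t)
        ≡⟨ eval-+ₚ (const I) (-ₚ (const A *ₚ u)) (1ℤ + t) ⟩
      eval (const I) (1ℤ + t) + eval (-ₚ (const A *ₚ u)) (1ℤ + t)
        ≡⟨ cong₂ _+_ (eval-const I (1ℤ + t)) (trans (eval--ₚ (const A *ₚ u) (1ℤ + t))
             (cong -_ (trans (eval-*ₚ (const A) u (1ℤ + t)) (cong (_* eval u (1ℤ + t)) (eval-const A (1ℤ + t)))))) ⟩
      I + - (A * eval u (1ℤ + t))
        ≡⟨ lemma I A t ⟩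
      (1ℤ + t) * (I - A) + - t * I
        ≡⟨ cong (λ z → (1ℤ + t) * (I - A) + - t * z) (does-≟ v w) ⟩
      (1ℤ + t) * (I - A) + - t * 𝟙 w v ∎
      where
      open ≡-Reasoning
      I A : ℤ
      I = 𝓘-matrix w v
      A = 𝓐-matrix w v

  -- The point `t = -1` is `u = 0`, where the matrix is the identity. This keeps `g` from being the
  -- zero polynomial, on which `order₁` is meaningless.
  eval-g≢0 : eval (taylor₁ g) -1ℤ ≢ 0ℤ
  eval-g≢0 eq = contradiction (trans (sym (trans (eval-g -1ℤ) (trans (det-cong (entrywise entry)) (det-𝟙 #V)))) eq) λ ()
    where
    lemma : ∀ b i → (1ℤ + -1ℤ) * b + - -1ℤ * i ≡ i
    lemma = solve-∀
    entry : ∀ w v → linear (1ℤ + -1ℤ) 𝓑𝓕-matrix (- -1ℤ) 𝟙 w v ≡ 𝟙 w v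
    entry w v = lemma (𝓑𝓕-matrix w v) (𝟙 w v)

  module _ {d : Vector ℤ #V} (B∼ : 𝓑𝓕-matrix ∼ diag d) where
    open Diagonalised B∼
    open BowenFranks B∼
    open Pencil B∼ using (N)

    saturated⇒𝓛 : ∀ v → Saturated v → Subgroup._∈ 𝓛 v
    saturated⇒𝓛 v sat = let q , eq = saturated⇒rationalImage v sat in q , tt , eq

    𝓛⇒saturated : ∀ v → Subgroup._∈ 𝓛 v → Saturated v
    𝓛⇒saturated v (q , _ , eq) = rationalImage⇒saturated v (q , eq)

    𝓡-cardinality : det N ≢ 0ℤ → HasCardinality 𝓡 ∣ det N ∣
    𝓡-cardinality det≢0 = coker-cardinality 𝓡 N det≢0 f s f-s image⇒≈ ≈⇒image
      where
      open AbelianGroup 𝓡 using (Carrier; _≈_)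
      f : Vector ℤ #V → Carrier
      f y = P (λ i → d i * y i) , Q⁻¹ y , tt , apply-Q⁻¹ y
      -- An element of `𝓡` carries a preimage `x` under `𝓑𝓕`, and `𝓑𝓕 x = P D (Q x)`.
      s : Carrier → Vector ℤ #V
      s (_ , x , _) = Q x
      f-s : ∀ c → f (s c) ≈ c
      f-s (v , x , _ , Bx≗v) = (λ _ → 0ℤ) , Subgroup.ε∈ 𝓛 , λ i →
        trans (GroupHomomorphism.ε-homo 𝓑𝓕 i) (sym (i≡j⇒i-j≡0 (trans (sym (apply-PDQ x i)) (Bx≗v i))))
      image⇒≈ : ∀ x y → InImage N (x − y) → f x ≈ f y
      image⇒≈ x y x−y∈ = let w , sat , Bw≗ = InImage-N⇒ x y x−y∈ in w , saturated⇒𝓛 w sat , Bw≗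
      ≈⇒image : ∀ x y → f x ≈ f y → InImage N (x − y)
      ≈⇒image x y (w , w∈𝓛 , Bw≗) = ⇒InImage-N x y w (𝓛⇒saturated w w∈𝓛) Bw≗

    leading-g : HasDefect 0ℤ → Pencil.leading B∼ ≢ 0ℤ × g* ≡ Pencil.leading B∼
    leading-g (ρ , ((x , independent) , _) , 0≡r-ρ) =
      order₀-unique (taylor₁ g) {x₀ = -1ℤ} eval-g≢0 (zeros d) (Pencil.leading B∼)
        (λ t → -1ℤ ^ zeros d * det (Pencil.pencil B∼ t))
        (λ t _ → trans (eval-g t) (Pencil.det-pencil B∼ t))
        (Pencil.det-pencil-mod B∼)
        -- Vanishing defect identifies `r` with the rank and so supplies the upper bound on the
        -- order of vanishing.
        (ℕ.≤-trans (ℕ.≤-reflexive (+-injective (i-j≡0⇒i≡j (+ r) (+ ρ) (sym 0≡r-ρ))))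
                   (independent⇒≤zeros x independent))

theorem2p11 : (X : Digraph) → Digraph.StronglyConnected X → Digraph.HasDefect X 0ℤ →
    ∃[ m ] (Digraph.HasMultiplier X m × HasCardinality (Digraph.𝓡 X) ∣ m ∣)
theorem2p11 X _ defect = from-diagonal (diagonalise (Digraph.𝓑𝓕-matrix X))
  where
  from-diagonal : ∃[ d ] (Digraph.𝓑𝓕-matrix X ∼ diag d) →
                  ∃[ m ] (Digraph.HasMultiplier X m × HasCardinality (Digraph.𝓡 X) ∣ m ∣)
  from-diagonal (d , B∼) = multiplier (leading-g X B∼ defect) (unit-* (det (diag (orOne ∘ d))))
    where
    open Pencil B∼ using (N; leading)
    sign δ κ : ℤ
    sign = -1ℤ ^ zeros d
    δ = det N
    κ = det (diag (orOne ∘ d))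
    multiplier : leading ≢ 0ℤ × Digraph.g* X ≡ leading → ∃[ ε ] (∣ ε ∣ ≡ 1 × ε * + ∣ κ ∣ ≡ κ) →
                 ∃[ m ] (Digraph.HasMultiplier X m × HasCardinality (Digraph.𝓡 X) ∣ m ∣)
    multiplier (leading≢0 , g*≡leading) (ε , ∣ε∣≡1 , ε∣κ∣≡κ) =
      -- The leading coefficient is `sign * δ * κ` with `κ = ε * ∣ κ ∣`; dividing by the torsion
      -- order `∣ κ ∣` leaves this integer, of absolute value `∣ δ ∣`.
      sign * δ * ε ,
      (∣ κ ∣ , BowenFranks.torsion-cardinality B∼ , g*≡) ,
      subst (HasCardinality (Digraph.𝓡 X)) (sym ∣m∣≡∣δ∣) (𝓡-cardinality X B∼ δ≢0)
      where
      -- A singular `N` would make the leading coefficient vanish; this nonvanishing is what makes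
      -- `𝓡` finite.
      δ≢0 : δ ≢ 0ℤ
      δ≢0 δ≡0 = leading≢0 (trans (cong (λ z → sign * (z * product (orOne ∘ d))) δ≡0)
        (trans (cong (sign *_) (*-zeroˡ (product (orOne ∘ d)))) (*-zeroʳ sign)))
      lemma : ∀ s δ ε k → s * (δ * (ε * k)) ≡ s * δ * ε * k
      lemma = solve-∀
      g*≡ : Digraph.g* X ≡ sign * δ * ε * + ∣ κ ∣
      g*≡ = begin
        Digraph.g* X                     ≡⟨ g*≡leading ⟩
        sign * (δ * product (orOne ∘ d)) ≡⟨ cong (λ z → sign * (δ * z)) (trans (sym (det-diag (orOne ∘ d))) (sym ε∣κ∣≡κ)) ⟩
        sign * (δ * (ε * + ∣ κ ∣))       ≡⟨ lemma sign δ ε (+ ∣ κ ∣) ⟩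
        sign * δ * ε * + ∣ κ ∣           ∎
        where open ≡-Reasoning
      ∣m∣≡∣δ∣ : ∣ sign * δ * ε ∣ ≡ ∣ δ ∣
      ∣m∣≡∣δ∣ = begin
        ∣ sign * δ * ε ∣              ≡⟨ abs-* (sign * δ) ε ⟩
        ∣ sign * δ ∣ ℕ.* ∣ ε ∣        ≡⟨ cong (∣ sign * δ ∣ ℕ.*_) ∣ε∣≡1 ⟩
        ∣ sign * δ ∣ ℕ.* 1            ≡⟨ ℕ.*-identityʳ ∣ sign * δ ∣ ⟩
        ∣ sign * δ ∣                  ≡⟨ abs-* sign δ ⟩
        ∣ sign ∣ ℕ.* ∣ δ ∣            ≡⟨ cong (ℕ._* ∣ δ ∣) (∣-1^k∣≡1 (zeros d)) ⟩
        1 ℕ.* ∣ δ ∣                   ≡⟨ ℕ.*-identityˡ ∣ δ ∣ ⟩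
        ∣ δ ∣                         ∎
        where open ≡-Reasoning
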